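{- Let $p$ be a prime with $p\equiv 1\pmod 4$. Then for $M=(p-1)/4$ and also for $M=p-1$, $$\sum_{k=0}^{M}(-1)^k(8k+1)\frac{(\frac14)_k^3}{k!^3}\equiv p(-1)^{(p-1)/4}+\frac{p^3}{16}E_{p-3}\left(\tfrac14\right)\pmod{p^4}.$$
   Context: $(x)_k=x(x+1)\cdots(x+k-1)$ is the Pochhammer symbol, with $(x)_0=1$. The Euler polynomials $E_n(x)$ are defined by $\sum_{n\ge 0}E_n(x)\frac{t^n}{n!}=\frac{2e^{xt}}{e^t+1}$. A congruence modulo $p^4$ between rational numbers whose denominators are prime to $p$ means that the difference lies in $p^4\mathbb{Z}_p$, where $\mathbb{Z}_p$ is the ring of $p$-adic integers. -}

module Defs where

open import Data.Fin.Base as Fin using (toℕ)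
open import Data.Integer.Base as ℤ using (ℤ; +_)
import Data.Integer.Divisibility.Signed as ℤ
import Data.Integer.Properties as ℤ
open import Data.Integer.Tactic.RingSolver using (solve-∀)
open import Data.Nat.Base as ℕ using (ℕ; zero; suc; _!)
import Data.Nat.Properties as ℕ
open import Data.Product.Base using (∃-syntax)
open import Data.Rational.Base
open import Data.Rational.Properties
open import Relation.Binary.PropositionalEquality

open import Algebra.Definitions.RawSemiring +-*-rawSemiring public using (_^_; sum)

fromℕ : ℕ → ℚ
fromℕ n = + n / 1

1/_! : ℕ → ℚ
1/ n ! = (+ 1 / (n !)) {{n ℕ.!≢0}}

∑[k≤_] : ℕ → (ℕ → ℚ) → ℚ
∑[k≤ n ] f = sum {suc n} (λ k → f (toℕ k))

pochhammer : ℚ → ℕ → ℚ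
pochhammer x zero    = 1ℚ
pochhammer x (suc k) = pochhammer x k * (x + fromℕ k)

-- Formal power series over ℚ, as coefficient sequences.

Series : Set
Series = ℕ → ℚ

const : ℚ → Series
const c zero    = c
const c (suc _) = 0ℚ

infixl 6 _+ₛ_
infixl 7 _*ₛ_ _÷ₛ_

_+ₛ_ : Series → Series → Series
(f +ₛ g) n = f n + g n

_*ₛ_ : Series → Series → Series
(f *ₛ g) n = ∑[k≤ n ] (λ k → f k * g (n ℕ.∸ k))

-- Long division: with c = f₀ / g₀, the quotient is c + t · (((f - c g) / t) / g).

_÷ₛ_ : (f g : Series) → .{{NonZero (g 0)}} → Series
(f ÷ₛ g) zero    = f 0 ÷ g 0
(f ÷ₛ g) (suc n) = ((λ m → f (suc m) - (f 0 ÷ g 0) * g (suc m)) ÷ₛ g) n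

÷ₛ-*ₛ : ∀ f g .{{_ : NonZero (g 0)}} n → ((f ÷ₛ g) *ₛ g) n ≡ f n
÷ₛ-*ₛ f g zero = begin
  f 0 * 1/ g 0 * g 0 + 0ℚ    ≡⟨ +-identityʳ _ ⟩
  f 0 * 1/ g 0 * g 0         ≡⟨ *-assoc (f 0) (1/ g 0) (g 0) ⟩
  f 0 * (1/ g 0 * g 0)       ≡⟨ cong (f 0 *_) (*-inverseˡ (g 0)) ⟩
  f 0 * 1ℚ                   ≡⟨ *-identityʳ (f 0) ⟩
  f 0                        ∎
  where open ≡-Reasoning
÷ₛ-*ₛ f g (suc n) = begin
  c * g (suc n) + ((f′ ÷ₛ g) *ₛ g) n          ≡⟨ cong (_+_ (c * g (suc n))) (÷ₛ-*ₛ f′ g n) ⟩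
  c * g (suc n) + (f (suc n) - c * g (suc n)) ≡⟨ +-comm (c * g (suc n)) _ ⟩
  f (suc n) - c * g (suc n) + c * g (suc n)   ≡⟨ +-assoc (f (suc n)) _ _ ⟩
  f (suc n) + (- (c * g (suc n)) + c * g (suc n))
    ≡⟨ cong (_+_ (f (suc n))) (+-inverseˡ (c * g (suc n))) ⟩
  f (suc n) + 0ℚ                              ≡⟨ +-identityʳ (f (suc n)) ⟩
  f (suc n)                                   ∎
  where
  open ≡-Reasoning
  c : ℚ
  c = f 0 ÷ g 0
  f′ : Series
  f′ m = f (suc m) - c * g (suc m)

-- exp[ x t] is the series e^{xt}.

exp[_t] : ℚ → Series
exp[ x t] n = x ^ n * 1/ n !

eulerPolynomial : ℕ → ℚ → ℚ
eulerPolynomial n x =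
  fromℕ (n !) * ((const (fromℕ 2) *ₛ exp[ x t]) ÷ₛ (exp[ 1ℚ t] +ₛ const 1ℚ)) n

-- p-adic integers, as elements of the inverse limit of the rings ℤ/pⁿ: the
-- n-th residue is a representative modulo pⁿ, so equality is _≈_, not _≡_.

record ℤₚ (p : ℕ) : Set where
  field
    residue  : ℕ → ℤ
    coherent : ∀ n → + (p ℕ.^ n) ℤ.∣ residue (suc n) ℤ.- residue n

open ℤₚ public

infix  4 _≈_
infixl 7 _*ₚ_

_≈_ : ∀ {p} → ℤₚ p → ℤₚ p → Set
_≈_ {p} x y = ∀ n → + (p ℕ.^ n) ℤ.∣ residue x n ℤ.- residue y n

ι : ∀ {p} → ℤ → ℤₚ p
ι a .residue  _ = a
ι a .coherent n = ℤ.divides ℤ.0ℤ (ℤ.+-inverseʳ a)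

_*ₚ_ : ∀ {p} → ℤₚ p → ℤₚ p → ℤₚ p
(x *ₚ y) .residue n = residue x n ℤ.* residue y n
_*ₚ_ {p} x y .coherent n =
  subst (+ (p ℕ.^ n) ℤ.∣_)
    (sym (split (residue x (suc n)) (residue x n) (residue y (suc n)) (residue y n)))
    (ℤ.∣m∣n⇒∣m+n (ℤ.∣n⇒∣m*n (residue x (suc n)) (coherent y n))
                  (ℤ.∣n⇒∣m*n (residue y n) (coherent x n)))
  where
  split : ∀ a b c d → a ℤ.* c ℤ.- b ℤ.* d ≡ a ℤ.* (c ℤ.- d) ℤ.+ d ℤ.* (a ℤ.- b)
  split = solve-∀

-- r ∈ pᵐ ℤₚ inside ℚₚ, the fraction field of ℤₚ (p prime): r = pᵐ z is stated
-- with the denominator of r cleared.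

_∈[_^_]ℤₚ : ℚ → ℕ → ℕ → Set
r ∈[ p ^ m ]ℤₚ = ∃[ z ] ι {p} (↧ r) *ₚ (ι (+ (p ℕ.^ m)) *ₚ z) ≈ ι (↥ r)

infix 4 _≡_[mod_^_]

_≡_[mod_^_] : ℚ → ℚ → ℕ → ℕ → Set
a ≡ b [mod p ^ m ] = (a - b) ∈[ p ^ m ]ℤₚ

module Submission where

-- Put a = 1/4, n = (p - 1)/4 and u = p/4, so that a = u - n. Replacing each factor
-- (a + j)³ / (1 + j)³ of (1/4)ₖ³ / k!³ by ((a + j)³ - c) / ((1 + j)³ + c) deforms the
-- sum over k ≤ n into G(c). Modulo p the signed products are symmetric under
-- k ↦ n - k while 8k + 1 is antisymmetric, so G(u³) ≡ G(0) mod p⁴. The terms with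
-- n < k < p carry a factor p³, and k ↦ p + n - k shows that they cancel mod p⁴.
--
-- Over the cube roots of unity G(u³) is a very-well-poised series with parameters
-- a - u = - n, a - ωu, a - ω²u. Whipple's transformation gives G(u³) = p Rₙ exactly, with
-- Rᵢ = Σₖ (-i)ₖ (i + 1 - 2u)ₖ / Π_{1 ≤ j ≤ k} (j² - uj + u²). Here
-- i² (Rᵢ + Rᵢ₋₁) ≡ 2u² mod p³, whereas i² (Eₘ(u - i) + Eₘ(u - i + 1)) ≡ 2 mod p for
-- m = p - 3 by Fermat. As Eₘ(u) ≡ Eₘ(0) ≡ 0 mod p, induction yields
-- Rᵢ ≡ (-1)ⁱ + u² Eₘ(u - i) mod p³, and i = n is the claim.

-- The value c = u³ is chosen for two reasons. The factor u³ - (a + j)³ vanishes at j = n, so the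
-- deformed series terminates there, and for every cube root of unity ζ the parameters a - ζu and 1
-- + ζu add up to 1 + a, which is well-poisedness; the weight 8k + 1 = 4 (a + 2k) is the
-- very-well-poised factor. At the same time p³ divides u³, so the deformation changes terms only
-- from p³ on and its effect is needed merely to first order mod p. The precision is budgeted:
-- Whipple's prefactor 4u = p supplies one power of p, hence Rₙ is wanted mod p³; there the Euler
-- term carries u², hence the Euler polynomial is wanted only mod p. Since ω is not rational, the
-- conjugates ωu and ω²u enter through their sum and product alone.

open import Defs
open import Algebra.Bundles using (CommutativeRing)
open import Data.Integer.Base as ℤ using (ℤ; +_)
import Data.Integer.Divisibility.Signed as ℤ
import Data.Integer.Properties as ℤ
import Data.Integer.Tactic.RingSolver as ℤ-Solver
open import Data.Maybe.Base using (just; nothing)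
open import Data.Nat.Coprimality as Coprime using (prime⇒coprime; coprime-Bézout)
open import Data.Nat.Base as ℕ using (ℕ; zero; suc; _∸_; _%_; _!; z≤n; s≤s)
open import Data.Nat.DivMod using (m≡m%n+[m/n]*n; m*n/n≡m)
open import Data.Nat.GCD using (module Bézout)
open import Data.Nat.Induction using (<-rec)
open import Data.Nat.Primality using (Prime; ¬prime[1])
import Data.Nat.Properties as ℕ
import Data.Nat.Tactic.RingSolver as ℕ-Solver
open import Data.Product.Base using (∃-syntax; _×_; _,_; proj₁; proj₂)
import Data.Rational.Base as ℚ
open import Data.Rational.Base hiding (1/_)
open import Data.Rational.Properties
open import Data.Rational.Unnormalised.Base using (mkℚᵘ; *≡*)
open import Data.Sum.Base using (_⊎_; inj₁; inj₂)
open import Function.Base using (_∘_)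
open import Level using (0ℓ)
open import Relation.Binary.PropositionalEquality hiding (J)
open import Relation.Nullary.Decidable using (Dec; yes; no)
open import Relation.Nullary.Negation using (contradiction)
open import Tactic.RingSolver using (solve-∀)
open import Tactic.RingSolver.Core.AlmostCommutativeRing using (AlmostCommutativeRing; fromCommutativeRing)

open import Algebra.Properties.Semiring.Exp (CommutativeRing.semiring +-*-commutativeRing) using (^-homo-*; ^-assocʳ)

open ≡-Reasoning

-- Linear certificates for equations in ℚ

ℚ-ring : AlmostCommutativeRing 0ℓ 0ℓ
ℚ-ring = fromCommutativeRing +-*-commutativeRing isZero
  where
  isZero : ∀ x → _
  isZero x with 0ℚ ≟ x
  ... | yes 0≡x = just 0≡x
  ... | no _    = nothing

-- An equation that follows from hypotheses becomes a pure polynomial identity once L - R is written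
-- as a combination of their differences, and such an identity is decided by the ring solver.
-- Inverses enter as variables `i` with the hypothesis x * i ≡ 1.
combine₁ : ∀ {L R A B} c → A ≡ B → L ≡ R + c * (A - B) → L ≡ R
combine₁ {R = R} {A = A} c refl identity = trans identity (vanish R c A)
  where
  vanish : ∀ R c A → R + c * (A - A) ≡ R
  vanish = solve-∀ ℚ-ring

combine₂ : ∀ {L R A B A′ B′} c → A ≡ B → ∀ c′ → A′ ≡ B′ →
  L ≡ R + c * (A - B) + c′ * (A′ - B′) → L ≡ R
combine₂ c A≡B c′ A′≡B′ identity = combine₁ c A≡B (combine₁ c′ A′≡B′ identity)

combine₃ : ∀ {L R A B A′ B′ A″ B″} c → A ≡ B → ∀ c′ → A′ ≡ B′ → ∀ c″ → A″ ≡ B″ →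
  L ≡ R + c * (A - B) + c′ * (A′ - B′) + c″ * (A″ - B″) → L ≡ R
combine₃ c A≡B c′ A′≡B′ c″ A″≡B″ identity =
  combine₂ c A≡B c′ A′≡B′ (combine₁ c″ A″≡B″ identity)

-- Inverses, with 0⁻¹ = 0

infixl 9 _⁻¹

_⁻¹ : ℚ → ℚ
x ⁻¹ with x ≟ 0ℚ
... | yes _   = 0ℚ
... | no  x≢0 = (ℚ.1/ x) {{≢-nonZero x≢0}}

*-⁻¹ : ∀ {x} → x ≢ 0ℚ → x * x ⁻¹ ≡ 1ℚ
*-⁻¹ {x} x≢0 with x ≟ 0ℚ
... | yes x≡0 = contradiction x≡0 x≢0
... | no  x≢0 = *-inverseʳ x {{≢-nonZero x≢0}}

*-cancelˡ : ∀ {x} y z → x ≢ 0ℚ → x * y ≡ x * z → y ≡ z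
*-cancelˡ {x} y z x≢0 xy≡xz =
  combine₂ (z - y) (*-⁻¹ x≢0) (x ⁻¹) xy≡xz (identity x (x ⁻¹) y z)
  where
  identity : ∀ x i y z → y ≡ z + (z - y) * (x * i - 1ℚ) + i * (x * y - x * z)
  identity = solve-∀ ℚ-ring

*≡1⇒≢0 : ∀ x y → x * y ≡ 1ℚ → x ≢ 0ℚ
*≡1⇒≢0 x y xy≡1 refl = 1≢0 (trans (sym xy≡1) (*-zeroˡ y))

⁻¹-unique : ∀ x y → x * y ≡ 1ℚ → x ⁻¹ ≡ y
⁻¹-unique x y xy≡1 =
  *-cancelˡ (x ⁻¹) y (*≡1⇒≢0 x y xy≡1) (trans (*-⁻¹ (*≡1⇒≢0 x y xy≡1)) (sym xy≡1))

⁻¹-≢0 : ∀ {x} → x ≢ 0ℚ → x ⁻¹ ≢ 0ℚ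
⁻¹-≢0 {x} x≢0 = *≡1⇒≢0 (x ⁻¹) x (trans (*-comm (x ⁻¹) x) (*-⁻¹ x≢0))

⁻¹-involutive : ∀ {x} → x ≢ 0ℚ → x ⁻¹ ⁻¹ ≡ x
⁻¹-involutive {x} x≢0 = ⁻¹-unique (x ⁻¹) x (trans (*-comm (x ⁻¹) x) (*-⁻¹ x≢0))

*-≢0 : ∀ {x y} → x ≢ 0ℚ → y ≢ 0ℚ → x * y ≢ 0ℚ
*-≢0 {x} {y} x≢0 y≢0 xy≡0 = y≢0 (*-cancelˡ y 0ℚ x≢0 (trans xy≡0 (sym (*-zeroʳ x))))

x≡0⇒x*y≡0 : ∀ {x} y → x ≡ 0ℚ → x * y ≡ 0ℚ
x≡0⇒x*y≡0 y refl = *-zeroˡ y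

*≢0⇒≢0 : ∀ c {x y} → y ≢ 0ℚ → c * x ≡ y → x ≢ 0ℚ
*≢0⇒≢0 c y≢0 cx≡y refl = y≢0 (trans (sym cx≡y) (*-zeroʳ c))

⁻¹-distrib-* : ∀ {x y} → x ≢ 0ℚ → y ≢ 0ℚ → (x * y) ⁻¹ ≡ x ⁻¹ * y ⁻¹
⁻¹-distrib-* {x} {y} x≢0 y≢0 = ⁻¹-unique (x * y) (x ⁻¹ * y ⁻¹)
  (combine₂ (y * y ⁻¹) (*-⁻¹ x≢0) 1ℚ (*-⁻¹ y≢0) (identity x y (x ⁻¹) (y ⁻¹)))
  where
  identity : ∀ x y i j → x * y * (i * j) ≡ 1ℚ + (y * j) * (x * i - 1ℚ) + 1ℚ * (y * j - 1ℚ)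
  identity = solve-∀ ℚ-ring

-- Integers in ℚ

fromℤ : ℤ → ℚ
fromℤ i = i / 1

-- `i / 1` is normalised through a gcd that is stuck for a variable `i`. In constructor form `_+_`
-- and `_*_` reduce, which gives the homomorphism laws below.
fromℤ-mkℚ : ∀ i → mkℚ i 0 (Coprime.sym (Coprime.1-coprimeTo _)) ≡ fromℤ i
fromℤ-mkℚ i = sym (↥p/↧p≡p _)

fromℤ-+ : ∀ i j → fromℤ (i ℤ.+ j) ≡ fromℤ i + fromℤ j
fromℤ-+ i j = sym (trans (sym (cong₂ _+_ (fromℤ-mkℚ i) (fromℤ-mkℚ j)))
  (cong fromℤ (cong₂ ℤ._+_ (ℤ.*-identityʳ i) (ℤ.*-identityʳ j))))

fromℤ-* : ∀ i j → fromℤ (i ℤ.* j) ≡ fromℤ i * fromℤ j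
fromℤ-* i j = sym (trans (sym (cong₂ _*_ (fromℤ-mkℚ i) (fromℤ-mkℚ j))) refl)

fromℤ-neg : ∀ i → fromℤ (ℤ.- i) ≡ - fromℤ i
fromℤ-neg i = begin
  fromℤ (ℤ.- i)                            ≡⟨ unique (fromℤ i) (fromℤ (ℤ.- i)) ⟩
  - fromℤ i + (fromℤ i + fromℤ (ℤ.- i))    ≡⟨ cong (_+_ (- fromℤ i)) (sym (fromℤ-+ i (ℤ.- i))) ⟩
  - fromℤ i + fromℤ (i ℤ.+ (ℤ.- i))        ≡⟨ cong (λ j → - fromℤ i + fromℤ j) (ℤ.+-inverseʳ i) ⟩
  - fromℤ i + 0ℚ                           ≡⟨ +-identityʳ _ ⟩
  - fromℤ i                                ∎
  where
  unique : ∀ x y → y ≡ - x + (x + y)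
  unique = solve-∀ ℚ-ring

fromℤ-injective : ∀ {i j} → fromℤ i ≡ fromℤ j → i ≡ j
fromℤ-injective {i} {j} e = cong ↥_ (trans (fromℤ-mkℚ i) (trans e (sym (fromℤ-mkℚ j))))

fromℕ-+ : ∀ m n → fromℕ (m ℕ.+ n) ≡ fromℕ m + fromℕ n
fromℕ-+ m n = fromℤ-+ (+ m) (+ n)

fromℕ-* : ∀ m n → fromℕ (m ℕ.* n) ≡ fromℕ m * fromℕ n
fromℕ-* m n = trans (cong fromℤ (ℤ.pos-* m n)) (fromℤ-* (+ m) (+ n))

fromℕ-suc : ∀ n → fromℕ (suc n) ≡ fromℕ n + 1ℚ
fromℕ-suc n = trans (cong fromℕ (ℕ.+-comm 1 n)) (fromℕ-+ n 1)

fromℕ-∸ : ∀ {m n} → n ℕ.≤ m → fromℕ (m ∸ n) ≡ fromℕ m - fromℕ n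
fromℕ-∸ {m} {n} n≤m = begin
  fromℕ (m ∸ n)                       ≡⟨ add-sub (fromℕ (m ∸ n)) (fromℕ n) ⟩
  fromℕ (m ∸ n) + fromℕ n - fromℕ n   ≡⟨ cong (_- fromℕ n) (sym (fromℕ-+ (m ∸ n) n)) ⟩
  fromℕ (m ∸ n ℕ.+ n) - fromℕ n       ≡⟨ cong (λ k → fromℕ k - fromℕ n) (ℕ.m∸n+n≡m n≤m) ⟩
  fromℕ m - fromℕ n                   ∎
  where
  add-sub : ∀ x y → x ≡ x + y - y
  add-sub = solve-∀ ℚ-ring

fromℕ-^ : ∀ m n → fromℕ (m ℕ.^ n) ≡ fromℕ m ^ n
fromℕ-^ m zero    = refl
fromℕ-^ m (suc n) = trans (fromℕ-* m (m ℕ.^ n)) (cong (fromℕ m *_) (fromℕ-^ m n))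

fromℕ-≢0 : ∀ n .{{_ : ℕ.NonZero n}} → fromℕ n ≢ 0ℚ
fromℕ-≢0 (suc n) e with () ← fromℤ-injective {+ suc n} {+ 0} e

1/n≡n⁻¹ : ∀ n .{{_ : ℕ.NonZero n}} → + 1 / n ≡ fromℕ n ⁻¹
1/n≡n⁻¹ n@(suc n-1) = sym (⁻¹-unique (fromℕ n) (+ 1 / n) (begin
  fromℕ n * (+ 1 / n)                                      ≡⟨ cong₂ _*_ (sym (fromℤ-mkℚ (+ n))) (↥p/↧p≡p 1/n) ⟩
  (+ n ℤ.* + 1) / (1 ℕ.* n)                                ≡⟨ /-cong (ℤ.*-identityʳ (+ n)) (ℕ.*-identityˡ n) ⟩
  + n / n                                                   ≡⟨ n/n≡1 ⟩
  1ℚ                                                        ∎))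
  where
  1/n : ℚ
  1/n = mkℚ (+ 1) n-1 (Coprime.1-coprimeTo n)
  n/n≡1 : + n / n ≡ 1ℚ
  n/n≡1 = fromℚᵘ-cong {x = mkℚᵘ (+ n) n-1} {y = mkℚᵘ (+ 1) 0} (*≡* (ℤ.*-comm (+ n) (+ 1)))

-- Finite sums

∑-zero : ∀ f → ∑[k≤ 0 ] f ≡ f 0
∑-zero f = +-identityʳ (f 0)

∑-snoc : ∀ n f → ∑[k≤ suc n ] f ≡ ∑[k≤ n ] f + f (suc n)
∑-snoc zero    f = identity (f 0) (f 1)
  where
  identity : ∀ x y → x + (y + 0ℚ) ≡ x + 0ℚ + y
  identity = solve-∀ ℚ-ring
∑-snoc (suc n) f = trans (cong (_+_ (f 0)) (∑-snoc n (f ∘ suc))) (sym (+-assoc (f 0) _ _))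

∑-cong : ∀ n {f g} → (∀ k → k ℕ.≤ n → f k ≡ g k) → ∑[k≤ n ] f ≡ ∑[k≤ n ] g
∑-cong zero    f≗g = cong (_+ 0ℚ) (f≗g 0 z≤n)
∑-cong (suc n) f≗g = cong₂ _+_ (f≗g 0 z≤n) (∑-cong n λ k k≤n → f≗g (suc k) (s≤s k≤n))

∑-+ : ∀ n f g → ∑[k≤ n ] (λ k → f k + g k) ≡ ∑[k≤ n ] f + ∑[k≤ n ] g
∑-+ zero    f g = identity (f 0) (g 0)
  where
  identity : ∀ x y → x + y + 0ℚ ≡ x + 0ℚ + (y + 0ℚ)
  identity = solve-∀ ℚ-ring
∑-+ (suc n) f g = trans (cong (_+_ (f 0 + g 0)) (∑-+ n (f ∘ suc) (g ∘ suc))) (identity (f 0) (g 0) _ _)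
  where
  identity : ∀ x y X Y → x + y + (X + Y) ≡ x + X + (y + Y)
  identity = solve-∀ ℚ-ring

∑-* : ∀ n c f → ∑[k≤ n ] (λ k → c * f k) ≡ c * ∑[k≤ n ] f
∑-* zero    c f = identity c (f 0)
  where
  identity : ∀ c x → c * x + 0ℚ ≡ c * (x + 0ℚ)
  identity = solve-∀ ℚ-ring
∑-* (suc n) c f = trans (cong (_+_ (c * f 0)) (∑-* n c (f ∘ suc))) (sym (*-distribˡ-+ c (f 0) _))

∑-- : ∀ n f g → ∑[k≤ n ] (λ k → f k - g k) ≡ ∑[k≤ n ] f - ∑[k≤ n ] g
∑-- n f g = begin
  ∑[k≤ n ] (λ k → f k - g k)                       ≡⟨ ∑-cong n (λ k _ → identity (f k) (g k)) ⟩
  ∑[k≤ n ] (λ k → f k + (- 1ℚ) * g k)              ≡⟨ ∑-+ n f (λ k → (- 1ℚ) * g k) ⟩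
  ∑[k≤ n ] f + ∑[k≤ n ] (λ k → (- 1ℚ) * g k)      ≡⟨ cong (_+_ (∑[k≤ n ] f)) (∑-* n (- 1ℚ) g) ⟩
  ∑[k≤ n ] f + (- 1ℚ) * ∑[k≤ n ] g                 ≡⟨ sym (identity (∑[k≤ n ] f) (∑[k≤ n ] g)) ⟩
  ∑[k≤ n ] f - ∑[k≤ n ] g                          ∎
  where
  identity : ∀ x y → x - y ≡ x + (- 1ℚ) * y
  identity = solve-∀ ℚ-ring

∑-swap : ∀ m n (f : ℕ → ℕ → ℚ) →
  ∑[k≤ m ] (λ i → ∑[k≤ n ] (f i)) ≡ ∑[k≤ n ] (λ j → ∑[k≤ m ] (λ i → f i j))
∑-swap zero    n f = trans (∑-zero (λ i → ∑[k≤ n ] (f i))) (∑-cong n λ j _ → sym (∑-zero (λ i → f i j)))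
∑-swap (suc m) n f = trans (cong (_+_ (∑[k≤ n ] (f 0))) (∑-swap m n (f ∘ suc)))
  (sym (∑-+ n (f 0) (λ j → ∑[k≤ m ] (λ i → f (suc i) j))))

∑-reverse : ∀ n f → ∑[k≤ n ] (λ k → f (n ∸ k)) ≡ ∑[k≤ n ] f
∑-reverse zero    f = refl
∑-reverse (suc n) f = begin
  f (suc n) + ∑[k≤ n ] (λ k → f (n ∸ k))   ≡⟨ cong (_+_ (f (suc n))) (∑-reverse n f) ⟩
  f (suc n) + ∑[k≤ n ] f                    ≡⟨ +-comm (f (suc n)) _ ⟩
  ∑[k≤ n ] f + f (suc n)                    ≡⟨ sym (∑-snoc n f) ⟩
  ∑[k≤ suc n ] f                            ∎

∑-split : ∀ n m f → ∑[k≤ suc n ℕ.+ m ] f ≡ ∑[k≤ n ] f + ∑[k≤ m ] (λ i → f (suc n ℕ.+ i))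
∑-split zero    m f = cong (_+ ∑[k≤ m ] (f ∘ suc)) (sym (∑-zero f))
∑-split (suc n) m f = trans (cong (_+_ (f 0)) (∑-split n m (f ∘ suc))) (sym (+-assoc (f 0) _ _))

∑-0 : ∀ n {f} → (∀ k → k ℕ.≤ n → f k ≡ 0ℚ) → ∑[k≤ n ] f ≡ 0ℚ
∑-0 n f≗0 = trans (∑-cong n f≗0) (trans (∑-cong n λ k _ → sym (*-zeroˡ 0ℚ))
  (trans (∑-* n 0ℚ (λ _ → 0ℚ)) (*-zeroˡ (∑[k≤ n ] (λ _ → 0ℚ)))))

-- Finite products

∏[j<_] : ℕ → (ℕ → ℚ) → ℚ
∏[j< zero  ] r = 1ℚ
∏[j< suc k ] r = ∏[j< k ] r * r k

∏-cong : ∀ k {r s} → (∀ j → j ℕ.< k → r j ≡ s j) → ∏[j< k ] r ≡ ∏[j< k ] s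
∏-cong zero    r≗s = refl
∏-cong (suc k) r≗s = cong₂ _*_ (∏-cong k λ j j<k → r≗s j (ℕ.m<n⇒m<1+n j<k)) (r≗s k ℕ.≤-refl)

∏-* : ∀ k r s → ∏[j< k ] (λ j → r j * s j) ≡ ∏[j< k ] r * ∏[j< k ] s
∏-* zero    r s = refl
∏-* (suc k) r s = trans (cong (_* (r k * s k)) (∏-* k r s)) (identity (∏[j< k ] r) (∏[j< k ] s) (r k) (s k))
  where
  identity : ∀ R S x y → R * S * (x * y) ≡ R * x * (S * y)
  identity = solve-∀ ℚ-ring

∏-split : ∀ m k r → ∏[j< m ℕ.+ k ] r ≡ ∏[j< m ] r * ∏[j< k ] (λ j → r (m ℕ.+ j))
∏-split m zero    r = trans (cong (λ l → ∏[j< l ] r) (ℕ.+-identityʳ m)) (sym (*-identityʳ _))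
∏-split m (suc k) r = begin
  ∏[j< m ℕ.+ suc k ] r                                           ≡⟨ cong (λ l → ∏[j< l ] r) (ℕ.+-suc m k) ⟩
  ∏[j< m ℕ.+ k ] r * r (m ℕ.+ k)                                ≡⟨ cong (_* r (m ℕ.+ k)) (∏-split m k r) ⟩
  ∏[j< m ] r * ∏[j< k ] (λ j → r (m ℕ.+ j)) * r (m ℕ.+ k)      ≡⟨ *-assoc (∏[j< m ] r) _ _ ⟩
  ∏[j< m ] r * (∏[j< k ] (λ j → r (m ℕ.+ j)) * r (m ℕ.+ k))    ∎

∏-≢0 : ∀ k r → (∀ j → r j ≢ 0ℚ) → ∏[j< k ] r ≢ 0ℚ
∏-≢0 zero    r r≢0 = 1≢0
∏-≢0 (suc k) r r≢0 = *-≢0 (∏-≢0 k r r≢0) (r≢0 k)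

-- Both sides are the binomial-like quotient V m / (V k · V (m ∸ k)), where V k = v 1 ⋯ v k.

∏-symmetric : ∀ m (v : ℕ → ℚ) → (∀ i → v (suc i) ≢ 0ℚ) → ∀ {k} → k ℕ.≤ m →
  ∏[j< m ∸ k ] (λ j → v (m ∸ j) * v (suc j) ⁻¹) ≡ ∏[j< k ] (λ j → v (m ∸ j) * v (suc j) ⁻¹)
∏-symmetric m v v≢0 {k} k≤m = *-cancelˡ (B (m ∸ k)) (B k) (*-≢0 (V≢0 k) (V≢0 (m ∸ k))) (begin
  V k * V (m ∸ k) * B (m ∸ k)                ≡⟨ cong (_* B (m ∸ k)) (*-comm (V k) (V (m ∸ k))) ⟩
  V (m ∸ k) * V k * B (m ∸ k)                ≡⟨ cong (λ i → V (m ∸ k) * V i * B (m ∸ k)) (sym (ℕ.m∸[m∸n]≡n k≤m)) ⟩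
  V (m ∸ k) * V (m ∸ (m ∸ k)) * B (m ∸ k)    ≡⟨ quotient (m ∸ k) (ℕ.m∸n≤m m k) ⟩
  V m                                         ≡⟨ sym (quotient k k≤m) ⟩
  V k * V (m ∸ k) * B k                       ∎)
  where
  V B : ℕ → ℚ
  V k = ∏[j< k ] (v ∘ suc)
  B k = ∏[j< k ] (λ j → v (m ∸ j) * v (suc j) ⁻¹)
  V≢0 : ∀ k → V k ≢ 0ℚ
  V≢0 k = ∏-≢0 k (v ∘ suc) v≢0
  regroup : ∀ V v V′ B w i → V * v * V′ * (B * (w * i)) ≡ V * (V′ * w) * B + V * V′ * w * B * (v * i - 1ℚ)
  regroup = solve-∀ ℚ-ring
  quotient : ∀ k → k ℕ.≤ m → V k * V (m ∸ k) * B k ≡ V m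
  quotient zero    _     = identity (V m)
    where
    identity : ∀ x → 1ℚ * x * 1ℚ ≡ x
    identity = solve-∀ ℚ-ring
  quotient (suc k) k<m = begin
    V k * v (suc k) * V (m ∸ suc k) * (B k * (v (m ∸ k) * v (suc k) ⁻¹))
      ≡⟨ combine₁ (V k * V (m ∸ suc k) * v (m ∸ k) * B k) (*-⁻¹ (v≢0 k)) (regroup (V k) (v (suc k)) (V (m ∸ suc k)) (B k) (v (m ∸ k)) (v (suc k) ⁻¹)) ⟩
    V k * (V (m ∸ suc k) * v (m ∸ k)) * B k
      ≡⟨ cong (λ i → V k * (V (m ∸ suc k) * v i) * B k) 1+[m∸1+k]≡m∸k ⟩
    V k * V (suc (m ∸ suc k)) * B k
      ≡⟨ cong (λ i → V k * V i * B k) (sym 1+[m∸1+k]≡m∸k) ⟩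
    V k * V (m ∸ k) * B k
      ≡⟨ quotient k (ℕ.<⇒≤ k<m) ⟩
    V m ∎
    where
    1+[m∸1+k]≡m∸k : m ∸ k ≡ suc (m ∸ suc k)
    1+[m∸1+k]≡m∸k = ℕ.+-∸-assoc 1 k<m

-- Pochhammer symbols

pochhammer-suc : ∀ x k → pochhammer x (suc k) ≡ x * pochhammer (x + 1ℚ) k
pochhammer-suc x zero    = identity x
  where
  identity : ∀ x → 1ℚ * (x + 0ℚ) ≡ x * 1ℚ
  identity = solve-∀ ℚ-ring
pochhammer-suc x (suc k) = begin
  pochhammer x (suc k) * (x + fromℕ (suc k))
    ≡⟨ cong₂ (λ a b → a * (x + b)) (pochhammer-suc x k) (fromℕ-suc k) ⟩
  x * pochhammer (x + 1ℚ) k * (x + (fromℕ k + 1ℚ))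
    ≡⟨ identity x (pochhammer (x + 1ℚ) k) (fromℕ k) ⟩
  x * (pochhammer (x + 1ℚ) k * (x + 1ℚ + fromℕ k))  ∎
  where
  identity : ∀ x P k → x * P * (x + (k + 1ℚ)) ≡ x * (P * (x + 1ℚ + k))
  identity = solve-∀ ℚ-ring

pochhammer-neg : ∀ {n k} → n ℕ.< k → pochhammer (- fromℕ n) k ≡ 0ℚ
pochhammer-neg {n} {suc k} (s≤s n≤k) with ℕ.m≤n⇒m<n∨m≡n n≤k
... | inj₁ n<k  = trans (cong (_* (- fromℕ n + fromℕ k)) (pochhammer-neg n<k)) (*-zeroˡ (- fromℕ n + fromℕ k))
... | inj₂ refl = trans (cong (_*_ (pochhammer (- fromℕ n) n)) (+-inverseˡ (fromℕ n)))
  (*-zeroʳ (pochhammer (- fromℕ n) n))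

-- The Pfaff-Saalschütz sum

-- With s = b + c and q = b c we have D x = (x + b) (x + c) and N x = (x - b) (x - c);
-- only s and q are used because b and c will be conjugate over ℚ.

module Saalschütz (a s q : ℚ) where

  D N : ℚ → ℚ
  D x = x * x + s * x + q
  N x = x * x - s * x + q

  -- In terms of b and c, `g k` is (a-b)_k (a-c)_k / ((1+b)_k (1+c)_k), and `P k i * y i` is the
  -- i-th term of the balanced ₃F₂ with upper parameters -k, a + k, 1 - a + b + c and lower
  -- parameters 1 + b, 1 + c.
  g y d : ℕ → ℚ
  g k = ∏[j< k ] (λ j → N (a + fromℕ j) * D (fromℕ (suc j)) ⁻¹)
  y i = ∏[j< i ] (λ j → (1ℚ - a + s + fromℕ j) * (fromℕ (suc j) * D (fromℕ (suc j))) ⁻¹)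
  d i = ∏[j< i ] (λ j → D (fromℕ (suc j)) ⁻¹)

  P : ℕ → ℕ → ℚ
  P k i = pochhammer (- fromℕ k) i * pochhammer (a + fromℕ k) i

  module _ (D≢0 : ∀ j → D (fromℕ (suc j)) ≢ 0ℚ) where

    -- Absorbs the i! that `∑-wP` produces when the two summations are combined in `whipple`.
    !*y : ∀ i → fromℕ (i !) * y i ≡ pochhammer (1ℚ - a + s) i * d i
    !*y zero    = refl
    !*y (suc i) = begin
      fromℕ (suc i !) * y (suc i)
        ≡⟨ cong (_* y (suc i)) (fromℕ-* (suc i) (i !)) ⟩
      I * fromℕ (i !) * (y i * (c * e))
        ≡⟨ combine₃ (c * I * e) (!*y i) (- (pochhammer (1ℚ - a + s) i * d i * c * I * e)) (*-⁻¹ (D≢0 i))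
             (pochhammer (1ℚ - a + s) i * d i * c * f) (*-⁻¹ (*-≢0 (fromℕ-≢0 (suc i)) (D≢0 i)))
             (identity I (D I) (fromℕ (i !)) (y i) c e f (pochhammer (1ℚ - a + s) i) (d i)) ⟩
      pochhammer (1ℚ - a + s) i * c * (d i * f)
        ∎
      where
      I c e f : ℚ
      I = fromℕ (suc i)
      c = 1ℚ - a + s + fromℕ i
      e = (I * D I) ⁻¹
      f = D I ⁻¹
      identity : ∀ I D F y c e f p d → I * F * (y * (c * e)) ≡
        p * c * (d * f) + (c * I * e) * (F * y - p * d) + (- (p * d * c * I * e)) * (D * f - 1ℚ) + (p * d * c * f) * (I * D * e - 1ℚ)
      identity = solve-∀ ℚ-ring

    -- The full sums satisfy a first-order recurrence in k. Its Zeilberger certificate is the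
    -- right-hand side: stopping at i leaves one hypergeometric term, whose factor (-k)_i vanishes
    -- as soon as i > k.
    recurrence-partial : ∀ k i → let K = fromℕ k; K′ = fromℕ (suc k); I = fromℕ i in
      D K′ * ∑[k≤ i ] (λ i → P (suc k) i * y i) - N (a + K) * ∑[k≤ i ] (λ i → P k i * y i)
        ≡ (K + K + 1ℚ + a) * (1ℚ - a + s + I) * (pochhammer (- K) i * pochhammer (a + K′) i) * y i
    recurrence-partial k zero = base (fromℕ k) (fromℕ (suc k)) (fromℕ-suc k)
      where
      identity : ∀ a s q K → ((K + 1ℚ) * (K + 1ℚ) + s * (K + 1ℚ) + q) * (1ℚ * 1ℚ * 1ℚ + 0ℚ)
        - ((a + K) * (a + K) - s * (a + K) + q) * (1ℚ * 1ℚ * 1ℚ + 0ℚ)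
        ≡ (K + K + 1ℚ + a) * (1ℚ - a + s + 0ℚ) * (1ℚ * 1ℚ) * 1ℚ
      identity = solve-∀ ℚ-ring
      base : ∀ K K′ → K′ ≡ K + 1ℚ → D K′ * (1ℚ * 1ℚ * 1ℚ + 0ℚ) - N (a + K) * (1ℚ * 1ℚ * 1ℚ + 0ℚ)
        ≡ (K + K + 1ℚ + a) * (1ℚ - a + s + 0ℚ) * (1ℚ * 1ℚ) * 1ℚ
      base K _ refl = identity a s q K
    recurrence-partial k (suc i) = begin
      D K′ * ∑[k≤ suc i ] (λ i → P (suc k) i * y i) - N (a + K) * ∑[k≤ suc i ] (λ i → P k i * y i)
        ≡⟨ cong₂ (λ u v → D K′ * u - N (a + K) * v)
             (∑-snoc i (λ i → P (suc k) i * y i)) (∑-snoc i (λ i → P k i * y i)) ⟩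
      D K′ * (S′ + P (suc k) (suc i) * y (suc i)) - N (a + K) * (S + P k (suc i) * y (suc i))
        -- Splitting off the first factor of (-(k+1))_{i+1} and of (a+k)_{i+1} expresses both sums
        -- through the common blocks `p` = (-k)_i and `r` = (a+k+1)_i.
        ≡⟨ cong₂ (λ u v → D K′ * (S′ + u * (r * (a + K′ + I)) * (y i * (c * e)))
                       - N (a + K) * (S + (p * (- K + I)) * v * (y i * (c * e))))
             (trans (pochhammer-suc (- K′) i) (cong (λ z → - K′ * pochhammer z i) -K′+1≡-K))
             (trans (pochhammer-suc (a + K) i) (cong (λ z → (a + K) * pochhammer z i) a+K+1≡a+K′)) ⟩
      D K′ * (S′ + - K′ * p * (r * (a + K′ + I)) * (y i * (c * e)))
        - N (a + K) * (S + p * (- K + I) * ((a + K) * r) * (y i * (c * e)))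
        ≡⟨ step K K′ I I′ S S′ p r (y i) e (fromℕ-suc k) (fromℕ-suc i)
             (*-⁻¹ (*-≢0 (fromℕ-≢0 (suc i)) (D≢0 i))) (recurrence-partial k i) ⟩
      (K + K + 1ℚ + a) * (1ℚ - a + s + I′) * (pochhammer (- K) (suc i) * pochhammer (a + K′) (suc i)) * y (suc i)
        ∎
      where
      K K′ I I′ S S′ p r c e : ℚ
      K = fromℕ k
      K′ = fromℕ (suc k)
      I = fromℕ i
      I′ = fromℕ (suc i)
      S = ∑[k≤ i ] (λ i → P k i * y i)
      S′ = ∑[k≤ i ] (λ i → P (suc k) i * y i)
      p = pochhammer (- K) i
      r = pochhammer (a + K′) i
      c = 1ℚ - a + s + I
      e = (I′ * D I′) ⁻¹
      a+K+1≡a+K′ : a + K + 1ℚ ≡ a + K′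
      a+K+1≡a+K′ = trans (+-assoc a K 1ℚ) (cong (_+_ a) (sym (fromℕ-suc k)))
      -K′+1≡-K : - K′ + 1ℚ ≡ - K
      -K′+1≡-K = trans (cong (λ z → - z + 1ℚ) (fromℕ-suc k)) (cancel K)
        where
        cancel : ∀ x → - (x + 1ℚ) + 1ℚ ≡ - x
        cancel = solve-∀ ℚ-ring
      identity : ∀ a s q K I S S′ p r y e →
        ((K + 1ℚ) * (K + 1ℚ) + s * (K + 1ℚ) + q) * (S′ + - (K + 1ℚ) * p * (r * (a + (K + 1ℚ) + I)) * (y * ((1ℚ - a + s + I) * e)))
        - ((a + K) * (a + K) - s * (a + K) + q) * (S + p * (- K + I) * ((a + K) * r) * (y * ((1ℚ - a + s + I) * e)))
        ≡ (K + K + 1ℚ + a) * (1ℚ - a + s + (I + 1ℚ)) * (p * (- K + I) * (r * (a + (K + 1ℚ) + I))) * (y * ((1ℚ - a + s + I) * e))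
        + (- ((K + K + 1ℚ + a) * (1ℚ - a + s + I) * (p * r) * y)) * ((I + 1ℚ) * ((I + 1ℚ) * (I + 1ℚ) + s * (I + 1ℚ) + q) * e - 1ℚ)
        + 1ℚ * (((K + 1ℚ) * (K + 1ℚ) + s * (K + 1ℚ) + q) * S′ - ((a + K) * (a + K) - s * (a + K) + q) * S
               - (K + K + 1ℚ + a) * (1ℚ - a + s + I) * (p * r) * y)
      identity = solve-∀ ℚ-ring
      step : ∀ K K′ I I′ S S′ p r y e → K′ ≡ K + 1ℚ → I′ ≡ I + 1ℚ → I′ * D I′ * e ≡ 1ℚ →
        D K′ * S′ - N (a + K) * S ≡ (K + K + 1ℚ + a) * (1ℚ - a + s + I) * (p * r) * y →
        D K′ * (S′ + - K′ * p * (r * (a + K′ + I)) * (y * ((1ℚ - a + s + I) * e)))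
        - N (a + K) * (S + p * (- K + I) * ((a + K) * r) * (y * ((1ℚ - a + s + I) * e)))
        ≡ (K + K + 1ℚ + a) * (1ℚ - a + s + I′) * (p * (- K + I) * (r * (a + K′ + I))) * (y * ((1ℚ - a + s + I) * e))
      step K _ I _ S S′ p r y e refl refl e-inverse previous =
        combine₂ (- ((K + K + 1ℚ + a) * (1ℚ - a + s + I) * (p * r) * y)) e-inverse 1ℚ previous (identity a s q K I S S′ p r y e)

    -- Induction on k by the recurrence. The upper limit n is independent of k, the terms beyond k
    -- being zero, so that the sums over k and i can later be interchanged.
    saalschütz : ∀ n {k} → k ℕ.≤ n → g k ≡ ∑[k≤ n ] (λ i → P k i * y i)
    saalschütz zero    {zero}  z≤n = refl
    saalschütz (suc n) {zero}  z≤n = sym (trans (cong (_+_ (1ℚ * 1ℚ * 1ℚ)) (∑-0 n λ i _ →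
      x≡0⇒x*y≡0 (y (suc i)) (x≡0⇒x*y≡0 (pochhammer (a + 0ℚ) (suc i)) (pochhammer-neg {0} {suc i} (s≤s z≤n))))) refl)
    saalschütz n {suc k} k<n = *-cancelˡ (g (suc k)) S′ (D≢0 k) (begin
      D K′ * (g k * (N (a + K) * D K′ ⁻¹))
        ≡⟨ combine₃ (N (a + K)) (saalschütz n (ℕ.<⇒≤ k<n)) (N (a + K) * g k) (*-⁻¹ (D≢0 k)) (- 1ℚ) recurrence
             (identity (D K′) (D K′ ⁻¹) (g k) (N (a + K)) S S′) ⟩
      D K′ * S′ ∎)
      where
      K K′ S S′ : ℚ
      K = fromℕ k
      K′ = fromℕ (suc k)
      S = ∑[k≤ n ] (λ i → P k i * y i)
      S′ = ∑[k≤ n ] (λ i → P (suc k) i * y i)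
      recurrence : D K′ * S′ - N (a + K) * S ≡ 0ℚ
      recurrence = trans (recurrence-partial k n)
        (x≡0⇒x*y≡0 (y n) (trans (cong (_*_ ((K + K + 1ℚ + a) * (1ℚ - a + s + fromℕ n)))
          (x≡0⇒x*y≡0 (pochhammer (a + K′) n) (pochhammer-neg k<n))) (*-zeroʳ ((K + K + 1ℚ + a) * (1ℚ - a + s + fromℕ n)))))
      identity : ∀ D i g N S S′ → D * (g * (N * i)) ≡ D * S′ + N * (g - S) + N * g * (D * i - 1ℚ) + (- 1ℚ) * (D * S′ - N * S - 0ℚ)
      identity = solve-∀ ℚ-ring

-- Very-well-poised sums

module WellPoised (a : ℚ) (denominator≢0 : ∀ n k → 1ℚ + a + fromℕ n + fromℕ k ≢ 0ℚ) where

  -- This is (-1)^k (-x)_k / (1+a+x)_k: the terminating parameter together with its well-poised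
  -- partner and the alternating sign.
  w : ℚ → ℕ → ℚ
  w x k = ∏[j< k ] (λ j → (x - fromℕ j) * (1ℚ + a + x + fromℕ j) ⁻¹)

  -- The quotient of the two products telescopes. The relation is kept cross-multiplied because N′ -
  -- K is zero at k = n + 1, where it is still used.
  w-suc : ∀ n k → let N = fromℕ n; N′ = fromℕ (suc n); K = fromℕ k in
    (N′ - K) * (a + N′ + K) * w N′ k ≡ N′ * (a + N′) * w N k
  w-suc n zero = identity a (fromℕ (suc n))
    where
    identity : ∀ a N → (N - 0ℚ) * (a + N + 0ℚ) * 1ℚ ≡ N * (a + N) * 1ℚ
    identity = solve-∀ ℚ-ring
  w-suc n (suc k) = step (fromℕ n) (fromℕ (suc n)) (fromℕ k) (fromℕ (suc k))
    (w (fromℕ n) k) (w (fromℕ (suc n)) k) _ _ (fromℕ-suc n) (fromℕ-suc k)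
    (*-⁻¹ (denominator≢0 n k)) (*-⁻¹ (denominator≢0 (suc n) k)) (w-suc n k)
    where
    identity : ∀ a N K W W′ i i′ →
      (N + 1ℚ - (K + 1ℚ)) * (a + (N + 1ℚ) + (K + 1ℚ)) * (W′ * ((N + 1ℚ - K) * i′))
      ≡ (N + 1ℚ) * (a + (N + 1ℚ)) * (W * ((N - K) * i))
      + (- ((N - K) * (N + 1ℚ - K) * W′)) * ((1ℚ + a + N + K) * i - 1ℚ)
      + ((N - K) * (N + 1ℚ - K) * W′) * ((1ℚ + a + (N + 1ℚ) + K) * i′ - 1ℚ)
      + ((N - K) * i) * ((N + 1ℚ - K) * (a + (N + 1ℚ) + K) * W′ - (N + 1ℚ) * (a + (N + 1ℚ)) * W)
    identity = solve-∀ ℚ-ring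
    step : ∀ N N′ K K′ W W′ i i′ → N′ ≡ N + 1ℚ → K′ ≡ K + 1ℚ →
      (1ℚ + a + N + K) * i ≡ 1ℚ → (1ℚ + a + N′ + K) * i′ ≡ 1ℚ →
      (N′ - K) * (a + N′ + K) * W′ ≡ N′ * (a + N′) * W →
      (N′ - K′) * (a + N′ + K′) * (W′ * ((N′ - K) * i′)) ≡ N′ * (a + N′) * (W * ((N - K) * i))
    step N _ K _ W W′ i i′ refl refl i-inverse i′-inverse previous =
      combine₃ (- ((N - K) * (N + 1ℚ - K) * W′)) i-inverse ((N - K) * (N + 1ℚ - K) * W′) i′-inverse
        ((N - K) * i) previous (identity a N K W W′ i i′)

  w-vanishes : ∀ n → w (fromℕ n) (suc n) ≡ 0ℚ
  w-vanishes n = trans (cong (_*_ (w (fromℕ n) n)) (x≡0⇒x*y≡0 i (+-inverseʳ (fromℕ n)))) (*-zeroʳ (w (fromℕ n) n))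
    where
    i : ℚ
    i = (1ℚ + a + fromℕ n + fromℕ n) ⁻¹

  -- The summand is Gosper-summable, so the partial sums have a closed form; at k = n the boundary
  -- term drops out. This is the base case of `∑-wP`.
  ∑-w : ∀ n k → let N = fromℕ n in
    ∑[k≤ k ] (λ k → (a + fromℕ k + fromℕ k) * w N k) ≡ a + N - (N - fromℕ k) * w N k
  ∑-w n zero = identity a (fromℕ n)
    where
    identity : ∀ a N → (a + 0ℚ + 0ℚ) * 1ℚ + 0ℚ ≡ a + N - (N - 0ℚ) * 1ℚ
    identity = solve-∀ ℚ-ring
  ∑-w n (suc k) = trans (∑-snoc k λ k → (a + fromℕ k + fromℕ k) * w (fromℕ n) k)
    (step (fromℕ n) (fromℕ k) (fromℕ (suc k)) (w (fromℕ n) k) _ _ (fromℕ-suc k) (*-⁻¹ (denominator≢0 n k)) (∑-w n k))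
    where
    identity : ∀ a N K W i S →
      S + (a + (K + 1ℚ) + (K + 1ℚ)) * (W * ((N - K) * i)) ≡ a + N - (N - (K + 1ℚ)) * (W * ((N - K) * i))
      + ((N - K) * W) * ((1ℚ + a + N + K) * i - 1ℚ) + 1ℚ * (S - (a + N - (N - K) * W))
    identity = solve-∀ ℚ-ring
    step : ∀ N K K′ W i S → K′ ≡ K + 1ℚ → (1ℚ + a + N + K) * i ≡ 1ℚ → S ≡ a + N - (N - K) * W →
      S + (a + K′ + K′) * (W * ((N - K) * i)) ≡ a + N - (N - K′) * (W * ((N - K) * i))
    step N K _ W i S refl i-inverse previous =
      combine₂ ((N - K) * W) i-inverse 1ℚ previous (identity a N K W i S)

  P : ℕ → ℕ → ℚ
  P k i = pochhammer (- fromℕ k) i * pochhammer (a + fromℕ k) i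

  c : ℚ → ℕ → ℚ
  c x k = (a + fromℕ k + fromℕ k) * w x k

  -- In the step the last factor (i - k)(a + k + i) of P k (1 + i) is split as
  -- (n - k)(a + n + k) - (n - i)(a + n + i), whose first part lowers n in w.

  ∑-wP : ∀ n i → let N = fromℕ n in
    ∑[k≤ n ] (λ k → c N k * P k i) ≡ (a + N) * (pochhammer (- N) i * fromℕ (i !))
  ∑-wP n zero = begin
    ∑[k≤ n ] (λ k → c N k * 1ℚ)          ≡⟨ ∑-cong n (λ k _ → *-identityʳ (c N k)) ⟩
    ∑[k≤ n ] (c N)                        ≡⟨ ∑-w n n ⟩
    a + N - (N - N) * w N n               ≡⟨ identity (a + N) N (w N n) ⟩
    (a + N) * 1ℚ                          ∎
    where
    N : ℚ
    N = fromℕ n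
    identity : ∀ x N w → x - (N - N) * w ≡ x * 1ℚ
    identity = solve-∀ ℚ-ring
  ∑-wP zero (suc i) = begin
    ∑[k≤ 0 ] (λ k → c 0ℚ k * P k (suc i))
      ≡⟨ ∑-zero (λ k → c 0ℚ k * P k (suc i)) ⟩
    c 0ℚ 0 * (Z * pochhammer (a + 0ℚ) (suc i))
      ≡⟨ cong (λ z → c 0ℚ 0 * (z * pochhammer (a + 0ℚ) (suc i))) Z≡0 ⟩
    c 0ℚ 0 * (0ℚ * pochhammer (a + 0ℚ) (suc i))
      ≡⟨ identity (c 0ℚ 0) (pochhammer (a + 0ℚ) (suc i)) (a + 0ℚ) (fromℕ (suc i !)) ⟩
    (a + 0ℚ) * (0ℚ * fromℕ (suc i !))
      ≡⟨ cong (λ z → (a + 0ℚ) * (z * fromℕ (suc i !))) (sym Z≡0) ⟩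
    (a + 0ℚ) * (Z * fromℕ (suc i !)) ∎
    where
    Z : ℚ
    Z = pochhammer (- fromℕ 0) (suc i)
    Z≡0 : Z ≡ 0ℚ
    Z≡0 = pochhammer-neg {0} {suc i} (s≤s z≤n)
    identity : ∀ x y z w → x * (0ℚ * y) ≡ z * (0ℚ * w)
    identity = solve-∀ ℚ-ring
  ∑-wP (suc n) (suc i) = begin
    ∑[k≤ suc n ] (λ k → c N′ k * P k (suc i))
      ≡⟨ ∑-cong (suc n) (λ k _ → summand k) ⟩
    ∑[k≤ suc n ] (λ k → N′ * (a + N′) * (c N k * P k i) - (N′ - I) * (a + N′ + I) * (c N′ k * P k i))
      ≡⟨ ∑-- (suc n) (λ k → N′ * (a + N′) * (c N k * P k i)) (λ k → (N′ - I) * (a + N′ + I) * (c N′ k * P k i)) ⟩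
    ∑[k≤ suc n ] (λ k → N′ * (a + N′) * (c N k * P k i)) - ∑[k≤ suc n ] (λ k → (N′ - I) * (a + N′ + I) * (c N′ k * P k i))
      ≡⟨ cong₂ _-_ (∑-* (suc n) (N′ * (a + N′)) (λ k → c N k * P k i))
           (∑-* (suc n) ((N′ - I) * (a + N′ + I)) (λ k → c N′ k * P k i)) ⟩
    N′ * (a + N′) * ∑[k≤ suc n ] (λ k → c N k * P k i) - (N′ - I) * (a + N′ + I) * ∑[k≤ suc n ] (λ k → c N′ k * P k i)
      ≡⟨ cong₂ (λ u v → N′ * (a + N′) * u - (N′ - I) * (a + N′ + I) * v) (trans drop-last (∑-wP n i)) (∑-wP (suc n) i) ⟩
    N′ * (a + N′) * ((a + N) * (B * F)) - (N′ - I) * (a + N′ + I) * ((a + N′) * (A * F))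
      ≡⟨ step N N′ I A B F (fromℕ-suc n) (trans (pochhammer-suc (- N′) i) (cong (λ z → - N′ * pochhammer z i) -N′+1≡-N)) ⟩
    (a + N′) * (A * (- N′ + I) * ((I + 1ℚ) * F))
      ≡⟨ cong (λ z → (a + N′) * (A * (- N′ + I) * z)) (sym (trans (fromℕ-* (suc i) (i !)) (cong (_* F) (fromℕ-suc i)))) ⟩
    (a + N′) * (pochhammer (- N′) (suc i) * fromℕ (suc i !)) ∎
    where
    N N′ I F A B : ℚ
    N = fromℕ n
    N′ = fromℕ (suc n)
    I = fromℕ i
    F = fromℕ (i !)
    A = pochhammer (- N′) i
    B = pochhammer (- N) i
    split : ∀ a N′ K I p r W W′ → (a + K + K) * W′ * (p * (- K + I) * (r * (a + K + I)))
      ≡ N′ * (a + N′) * ((a + K + K) * W * (p * r)) - (N′ - I) * (a + N′ + I) * ((a + K + K) * W′ * (p * r))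
      + (a + K + K) * (p * r) * ((N′ - K) * (a + N′ + K) * W′ - N′ * (a + N′) * W)
    split = solve-∀ ℚ-ring
    summand : ∀ k → c N′ k * P k (suc i) ≡ N′ * (a + N′) * (c N k * P k i) - (N′ - I) * (a + N′ + I) * (c N′ k * P k i)
    summand k = combine₁ ((a + fromℕ k + fromℕ k) * P k i) (w-suc n k)
      (split a N′ (fromℕ k) I (pochhammer (- fromℕ k) i) (pochhammer (a + fromℕ k) i) (w N k) (w N′ k))
    drop-last : ∑[k≤ suc n ] (λ k → c N k * P k i) ≡ ∑[k≤ n ] (λ k → c N k * P k i)
    drop-last = trans (∑-snoc n (λ k → c N k * P k i)) (trans (cong (_+_ (∑[k≤ n ] (λ k → c N k * P k i)))
      (x≡0⇒x*y≡0 (P (suc n) i) (trans (cong (_*_ (a + N′ + N′)) (w-vanishes n)) (*-zeroʳ (a + N′ + N′)))))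
      (+-identityʳ (∑[k≤ n ] (λ k → c N k * P k i))))
    -N′+1≡-N : - N′ + 1ℚ ≡ - N
    -N′+1≡-N = trans (cong (λ z → - z + 1ℚ) (fromℕ-suc n)) (cancel N)
      where
      cancel : ∀ x → - (x + 1ℚ) + 1ℚ ≡ - x
      cancel = solve-∀ ℚ-ring
    identity : ∀ a N I A B F →
      (N + 1ℚ) * (a + (N + 1ℚ)) * ((a + N) * (B * F)) - (N + 1ℚ - I) * (a + (N + 1ℚ) + I) * ((a + (N + 1ℚ)) * (A * F))
      ≡ (a + (N + 1ℚ)) * (A * (- (N + 1ℚ) + I) * ((I + 1ℚ) * F))
      + ((a + (N + 1ℚ)) * (a + N) * F) * (A * (- (N + 1ℚ) + I) - - (N + 1ℚ) * B)
    identity = solve-∀ ℚ-ring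
    step : ∀ N N′ I A B F → N′ ≡ N + 1ℚ → A * (- N′ + I) ≡ - N′ * B →
      N′ * (a + N′) * ((a + N) * (B * F)) - (N′ - I) * (a + N′ + I) * ((a + N′) * (A * F))
      ≡ (a + N′) * (A * (- N′ + I) * ((I + 1ℚ) * F))
    step N _ I A B F refl pochhammer-shift =
      combine₁ ((a + (N + 1ℚ)) * (a + N) * F) pochhammer-shift (identity a N I A B F)

  -- The limiting case d = 1, e → ∞ of Whipple's transformation of a terminating very-well-poised ₇F₆.

  whipple : ∀ s q → let open Saalschütz a s q using (D; g; d) in (∀ j → D (fromℕ (suc j)) ≢ 0ℚ) → ∀ n → let N = fromℕ n in
    ∑[k≤ n ] (λ k → (a + fromℕ k + fromℕ k) * (w N k * g k))
      ≡ (a + N) * ∑[k≤ n ] (λ i → pochhammer (- N) i * pochhammer (1ℚ - a + s) i * d i)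
  whipple s q D≢0 n = begin
    ∑[k≤ n ] (λ k → (a + fromℕ k + fromℕ k) * (w N k * g k))
      -- Bailey's argument: expand `g k` by Saalschütz, interchange the sums, and evaluate the inner
      -- sum over k by `∑-wP`.
      ≡⟨ ∑-cong n (λ k k≤n → trans (sym (*-assoc (a + fromℕ k + fromℕ k) (w N k) (g k))) (cong (_*_ (c N k)) (saalschütz D≢0 n k≤n))) ⟩
    ∑[k≤ n ] (λ k → c N k * ∑[k≤ n ] (λ i → P k i * y i))
      ≡⟨ ∑-cong n (λ k _ → sym (∑-* n (c N k) (λ i → P k i * y i))) ⟩
    ∑[k≤ n ] (λ k → ∑[k≤ n ] (λ i → c N k * (P k i * y i)))
      ≡⟨ ∑-swap n n (λ k i → c N k * (P k i * y i)) ⟩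
    ∑[k≤ n ] (λ i → ∑[k≤ n ] (λ k → c N k * (P k i * y i)))
      ≡⟨ ∑-cong n (λ i _ → summand i) ⟩
    ∑[k≤ n ] (λ i → (a + N) * (pochhammer (- N) i * pochhammer (1ℚ - a + s) i * d i))
      ≡⟨ ∑-* n (a + N) (λ i → pochhammer (- N) i * pochhammer (1ℚ - a + s) i * d i) ⟩
    (a + N) * ∑[k≤ n ] (λ i → pochhammer (- N) i * pochhammer (1ℚ - a + s) i * d i) ∎
    where
    open Saalschütz a s q using (D; g; d; y; saalschütz; !*y)
    N : ℚ
    N = fromℕ n
    regroup : ∀ c P y → c * (P * y) ≡ y * (c * P)
    regroup = solve-∀ ℚ-ring
    identity : ∀ x p F y q d → y * (x * (p * F)) ≡ x * (p * q * d) + x * p * (F * y - q * d)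
    identity = solve-∀ ℚ-ring
    summand : ∀ i → ∑[k≤ n ] (λ k → c N k * (P k i * y i)) ≡ (a + N) * (pochhammer (- N) i * pochhammer (1ℚ - a + s) i * d i)
    summand i = begin
      ∑[k≤ n ] (λ k → c N k * (P k i * y i))
        ≡⟨ ∑-cong n (λ k _ → regroup (c N k) (P k i) (y i)) ⟩
      ∑[k≤ n ] (λ k → y i * (c N k * P k i))
        ≡⟨ ∑-* n (y i) (λ k → c N k * P k i) ⟩
      y i * ∑[k≤ n ] (λ k → c N k * P k i)
        ≡⟨ cong (_*_ (y i)) (∑-wP n i) ⟩
      y i * ((a + N) * (pochhammer (- N) i * fromℕ (i !)))
        ≡⟨ combine₁ ((a + N) * pochhammer (- N) i) (!*y D≢0 i)
             (identity (a + N) (pochhammer (- N) i) (fromℕ (i !)) (y i) (pochhammer (1ℚ - a + s) i) (d i)) ⟩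
      (a + N) * (pochhammer (- N) i * pochhammer (1ℚ - a + s) i * d i) ∎

-- Divisibility by powers of p in the localisation of ℤ at p

IsInteger : ℚ → Set
IsInteger x = ∃[ i ] x ≡ fromℤ i

int-ℤ : ∀ i → IsInteger (fromℤ i)
int-ℤ i = i , refl

int-+ : ∀ {x y} → IsInteger x → IsInteger y → IsInteger (x + y)
int-+ (i , x≡i) (j , y≡j) = i ℤ.+ j , trans (cong₂ _+_ x≡i y≡j) (sym (fromℤ-+ i j))

int-* : ∀ {x y} → IsInteger x → IsInteger y → IsInteger (x * y)
int-* (i , x≡i) (j , y≡j) = i ℤ.* j , trans (cong₂ _*_ x≡i y≡j) (sym (fromℤ-* i j))

int-neg : ∀ {x} → IsInteger x → IsInteger (- x)
int-neg (i , x≡i) = ℤ.- i , trans (cong -_ x≡i) (sym (fromℤ-neg i))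

x*↧x≡↥x : ∀ x → x * fromℤ (↧ x) ≡ fromℤ (↥ x)
x*↧x≡↥x x@(mkℚ i d-1 _) = begin
  x * fromℤ (↧ x)                        ≡⟨ cong (_*_ x) (sym (fromℤ-mkℚ (↧ x))) ⟩
  (i ℤ.* + suc d-1) / (suc d-1 ℕ.* 1)   ≡⟨ /-cong {p₁ = i ℤ.* + suc d-1} {q₁ = suc d-1 ℕ.* 1} {q₂ = suc d-1} refl (ℕ.*-identityʳ (suc d-1)) ⟩
  (i ℤ.* + suc d-1) / suc d-1            ≡⟨ fromℚᵘ-cong {x = mkℚᵘ (i ℤ.* + suc d-1) d-1} {y = mkℚᵘ i 0} (*≡* (ℤ.*-identityʳ _)) ⟩
  fromℤ i                                ∎

module Ideals (p : ℕ) where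

  P : ℚ
  P = fromℕ p

  -- x ∈𝔭^ m says x ∈ pᵐ ℤ₍ₚ₎. Denominators can be taken ≡ 1 mod p, which makes
  -- the closure properties independent of primality.

  infix 4 _∈𝔭^_
  record _∈𝔭^_ (x : ℚ) (m : ℕ) : Set where
    constructor ⟪_,_,_⟫
    field
      {d z}     : ℚ
      d-integer : IsInteger d
      z-integer : IsInteger z
      equation  : x * (1ℚ + P * d) ≡ P ^ m * z

  private
    P-integer : IsInteger P
    P-integer = + p , refl

    1-integer : IsInteger 1ℚ
    1-integer = + 1 , refl

    1+Pd-integer : ∀ {d} → IsInteger d → IsInteger (1ℚ + P * d)
    1+Pd-integer d-int = int-+ 1-integer (int-* P-integer d-int)

    -- Chosen so that (1 + P d)(1 + P e) = 1 + P (d ⋆ e): products of admissible denominators are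
    -- admissible.
    _⋆_ : ℚ → ℚ → ℚ
    d ⋆ e = d + e + P * (d * e)

    ⋆-integer : ∀ {d e} → IsInteger d → IsInteger e → IsInteger (d ⋆ e)
    ⋆-integer d-int e-int = int-+ (int-+ d-int e-int) (int-* P-integer (int-* d-int e-int))

  ∈-resp : ∀ {m x y} → x ≡ y → x ∈𝔭^ m → y ∈𝔭^ m
  ∈-resp refl x∈ = x∈

  integer∈ : ∀ {x} → IsInteger x → x ∈𝔭^ 0
  integer∈ {x} x-int = ⟪ int-ℤ (+ 0) , x-int , identity P x ⟫
    where
    identity : ∀ P x → x * (1ℚ + P * 0ℚ) ≡ 1ℚ * x
    identity = solve-∀ ℚ-ring

  ℕ∈ : ∀ n → fromℕ n ∈𝔭^ 0
  ℕ∈ n = integer∈ (int-ℤ (+ n))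

  1∈ : 1ℚ ∈𝔭^ 0
  1∈ = ℕ∈ 1

  0∈ : ∀ {m} → 0ℚ ∈𝔭^ m
  0∈ {m} = ⟪ int-ℤ (+ 0) , int-ℤ (+ 0) , identity P (P ^ m) ⟫
    where
    identity : ∀ P Q → 0ℚ * (1ℚ + P * 0ℚ) ≡ Q * 0ℚ
    identity = solve-∀ ℚ-ring

  P∈ : P ∈𝔭^ 1
  P∈ = ⟪ int-ℤ (+ 0) , int-ℤ (+ 1) , identity P ⟫
    where
    identity : ∀ P → P * (1ℚ + P * 0ℚ) ≡ P * 1ℚ * 1ℚ
    identity = solve-∀ ℚ-ring

  infixl 6 _∈+_ _∈-_
  infixl 7 _∈*_

  _∈+_ : ∀ {m x y} → x ∈𝔭^ m → y ∈𝔭^ m → x + y ∈𝔭^ m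
  _∈+_ {m} {x} {y} (⟪_,_,_⟫ {d} {z} d-int z-int x-eq) (⟪_,_,_⟫ {e} {w} e-int w-int y-eq) =
    ⟪ ⋆-integer d-int e-int , int-+ (int-* z-int (1+Pd-integer e-int)) (int-* w-int (1+Pd-integer d-int))
    , combine₂ (1ℚ + P * e) x-eq (1ℚ + P * d) y-eq (identity P (P ^ m) x y d e z w) ⟫
    where
    identity : ∀ P Q x y d e z w → (x + y) * (1ℚ + P * (d + e + P * (d * e))) ≡
      Q * (z * (1ℚ + P * e) + w * (1ℚ + P * d)) + (1ℚ + P * e) * (x * (1ℚ + P * d) - Q * z) + (1ℚ + P * d) * (y * (1ℚ + P * e) - Q * w)
    identity = solve-∀ ℚ-ring

  _∈*_ : ∀ {m n x y} → x ∈𝔭^ m → y ∈𝔭^ n → x * y ∈𝔭^ (m ℕ.+ n)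
  _∈*_ {m} {n} {x} {y} (⟪_,_,_⟫ {d} {z} d-int z-int x-eq) (⟪_,_,_⟫ {e} {w} e-int w-int y-eq) =
    ⟪ ⋆-integer d-int e-int , int-* z-int w-int
    , trans (combine₂ (y * (1ℚ + P * e)) x-eq (P ^ m * z) y-eq (identity P (P ^ m) (P ^ n) x y d e z w))
        (cong (_* (z * w)) (sym (^-homo-* P m n))) ⟫
    where
    identity : ∀ P Q R x y d e z w → (x * y) * (1ℚ + P * (d + e + P * (d * e))) ≡
      Q * R * (z * w) + y * (1ℚ + P * e) * (x * (1ℚ + P * d) - Q * z) + Q * z * (y * (1ℚ + P * e) - R * w)
    identity = solve-∀ ℚ-ring

  ∈-neg : ∀ {m x} → x ∈𝔭^ m → - x ∈𝔭^ m
  ∈-neg {m} {x} (⟪_,_,_⟫ {d} {z} d-int z-int x-eq) =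
    ⟪ d-int , int-neg z-int , combine₁ (- 1ℚ) x-eq (identity P (P ^ m) x d z) ⟫
    where
    identity : ∀ P Q x d z → - x * (1ℚ + P * d) ≡ Q * - z + (- 1ℚ) * (x * (1ℚ + P * d) - Q * z)
    identity = solve-∀ ℚ-ring

  _∈-_ : ∀ {m x y} → x ∈𝔭^ m → y ∈𝔭^ m → x - y ∈𝔭^ m
  x∈ ∈- y∈ = x∈ ∈+ ∈-neg y∈

  ∈-pred : ∀ {m x} → x ∈𝔭^ suc m → x ∈𝔭^ m
  ∈-pred {m} {x} (⟪_,_,_⟫ {d} {z} d-int z-int x-eq) =
    ⟪ d-int , int-* P-integer z-int , trans x-eq (identity P (P ^ m) z) ⟫
    where
    identity : ∀ P Q z → P * Q * z ≡ Q * (P * z)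
    identity = solve-∀ ℚ-ring

  ∈-weaken : ∀ {m x} → x ∈𝔭^ m → x ∈𝔭^ 0
  ∈-weaken {zero}  x∈ = x∈
  ∈-weaken {suc m} x∈ = ∈-weaken (∈-pred x∈)

  ∈-∑ : ∀ {m} n {f} → (∀ k → k ℕ.≤ n → f k ∈𝔭^ m) → ∑[k≤ n ] f ∈𝔭^ m
  ∈-∑ zero    f∈ = f∈ 0 z≤n ∈+ 0∈
  ∈-∑ (suc n) f∈ = f∈ 0 z≤n ∈+ ∈-∑ n λ k k≤n → f∈ (suc k) (s≤s k≤n)

  ∈-∏ : ∀ k {r} → (∀ j → j ℕ.< k → r j ∈𝔭^ 0) → ∏[j< k ] r ∈𝔭^ 0
  ∈-∏ zero    r∈ = 1∈
  ∈-∏ (suc k) r∈ = ∈-∏ k (λ j j<k → r∈ j (ℕ.m<n⇒m<1+n j<k)) ∈* r∈ k ℕ.≤-refl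

  ∈-^ : ∀ {x} k → x ∈𝔭^ 0 → x ^ k ∈𝔭^ 0
  ∈-^ zero    x∈ = 1∈
  ∈-^ (suc k) x∈ = x∈ ∈* ∈-^ k x∈

  ∏-cong∈ : ∀ k {r s} → (∀ j → j ℕ.< k → r j ∈𝔭^ 0 × s j ∈𝔭^ 0 × r j - s j ∈𝔭^ 1) → ∏[j< k ] r - ∏[j< k ] s ∈𝔭^ 1
  ∏-cong∈ zero    _   = 0∈
  ∏-cong∈ (suc k) {r} {s} r≡s =
    ∈-resp (identity (∏[j< k ] r) (∏[j< k ] s) (r k) (s k))
      (∏-cong∈ k below ∈* proj₁ (r≡s k ℕ.≤-refl)
        ∈+ ∈-∏ k (λ j j<k → proj₁ (proj₂ (below j j<k))) ∈* proj₂ (proj₂ (r≡s k ℕ.≤-refl)))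
    where
    below : ∀ j → j ℕ.< k → _
    below j j<k = r≡s j (ℕ.m<n⇒m<1+n j<k)
    identity : ∀ R S x y → (R - S) * x + S * (x - y) ≡ R * x - S * y
    identity = solve-∀ ℚ-ring

  ^-cong∈ : ∀ {l x y} k → x ∈𝔭^ 0 → y ∈𝔭^ 0 → x - y ∈𝔭^ l → x ^ k - y ^ k ∈𝔭^ l
  ^-cong∈ zero    _  _  _   = 0∈
  ^-cong∈ {x = x} {y} (suc k) x∈ y∈ x≡y =
    ∈-resp (identity x y (x ^ k) (y ^ k)) (x∈ ∈* ^-cong∈ k x∈ y∈ x≡y ∈+ ∈-^ k y∈ ∈* x≡y)
    where
    identity : ∀ x y X Y → x * (X - Y) + Y * (x - y) ≡ x * X - y * Y
    identity = solve-∀ ℚ-ring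

  -- An inverse modulo p is what Bézout provides, and the same witness serves every x′ ≡ x mod p.
  -- The integrality of the true inverse is recovered in `unit-⁻¹`.
  record Unit (x : ℚ) : Set where
    field
      {y}      : ℚ
      integral : x ∈𝔭^ 0
      y∈       : y ∈𝔭^ 0
      xy≡1     : x * y - 1ℚ ∈𝔭^ 1

  open Unit public using (integral)

  unit-1 : Unit 1ℚ
  unit-1 = record { integral = 1∈ ; y∈ = 1∈ ; xy≡1 = 0∈ }

  unit-* : ∀ {x x′} → Unit x → Unit x′ → Unit (x * x′)
  unit-* {x} {x′} u u′ = record
    { integral = integral u ∈* integral u′
    ; y∈       = U.y∈ ∈* U′.y∈
    ; xy≡1     = ∈-resp (identity x U.y x′ U′.y) (U.xy≡1 ∈* (integral u′ ∈* U′.y∈) ∈+ U′.xy≡1)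
    }
    where
    module U = Unit u
    module U′ = Unit u′
    identity : ∀ x y x′ y′ → (x * y - 1ℚ) * (x′ * y′) + (x′ * y′ - 1ℚ) ≡ x * x′ * (y * y′) - 1ℚ
    identity = solve-∀ ℚ-ring

  unit-≡ : ∀ {x x′} → Unit x → x′ - x ∈𝔭^ 1 → Unit x′
  unit-≡ {x} {x′} u x′≡x = record
    { integral = ∈-resp (cancel x x′) (integral u ∈+ ∈-weaken x′≡x)
    ; y∈       = U.y∈
    ; xy≡1     = ∈-resp (identity x x′ U.y) (U.xy≡1 ∈+ x′≡x ∈* U.y∈)
    }
    where
    module U = Unit u
    cancel : ∀ x x′ → x + (x′ - x) ≡ x′
    cancel = solve-∀ ℚ-ring
    identity : ∀ x x′ y → x * y - 1ℚ + (x′ - x) * y ≡ x′ * y - 1ℚ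
    identity = solve-∀ ℚ-ring

  -- If xy - 1 = pz / (1 + pd), then xy = (1 + p(d + z)) / (1 + pd), so 1/x = y (1 + pd) / (1 + p(d
  -- + z)), whose new denominator is again 1 mod p.
  unit-⁻¹ : ∀ {x} → Unit x → x ⁻¹ ∈𝔭^ 0
  unit-⁻¹ {x} u = by-cases (x ≟ 0ℚ) (Unit.y∈ u) (Unit.xy≡1 u)
    where
    y : ℚ
    y = Unit.y u
    identity : ∀ P x y i d e z w → i * (1ℚ + P * (e + (d + z) + P * (e * (d + z)))) ≡ 1ℚ * (w * (1ℚ + P * d))
      + y * (1ℚ + P * d) * (1ℚ + P * e) * (x * i - 1ℚ)
      + (- (i * (1ℚ + P * e))) * ((x * y - 1ℚ) * (1ℚ + P * d) - P * 1ℚ * z) + (1ℚ + P * d) * (y * (1ℚ + P * e) - 1ℚ * w)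
    identity = solve-∀ ℚ-ring
    by-cases : Dec (x ≡ 0ℚ) → y ∈𝔭^ 0 → x * y - 1ℚ ∈𝔭^ 1 → x ⁻¹ ∈𝔭^ 0
    -- For p = 1 even zero is a unit in this sense; the convention 0⁻¹ = 0 settles the case.
    by-cases (yes refl) _ _ = 0∈
    by-cases (no x≢0) (⟪_,_,_⟫ {e} {w} e-int w-int y-eq) (⟪_,_,_⟫ {d} {z} d-int z-int xy-eq) =
      ⟪ ⋆-integer e-int (int-+ d-int z-int) , int-* w-int (1+Pd-integer d-int)
      , combine₃ (y * (1ℚ + P * d) * (1ℚ + P * e)) (*-⁻¹ x≢0) (- (x ⁻¹ * (1ℚ + P * e))) xy-eq (1ℚ + P * d) y-eq
          (identity P x y (x ⁻¹) d e z w) ⟫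

  unit-cancel : ∀ {k x} z → x ≢ 0ℚ → Unit x → x * z ∈𝔭^ k → z ∈𝔭^ k
  unit-cancel {x = x} z x≢0 u xz∈ = ∈-resp (combine₁ z (*-⁻¹ x≢0) (identity x (x ⁻¹) z)) (unit-⁻¹ u ∈* xz∈)
    where
    identity : ∀ x i z → i * (x * z) ≡ z + z * (x * i - 1ℚ)
    identity = solve-∀ ℚ-ring

  unit-ℕ : Prime p → ∀ {j} .{{_ : ℕ.NonZero j}} → j ℕ.< p → Unit (fromℕ j)
  unit-ℕ p-prime {j} j<p with coprime-Bézout (prime⇒coprime p-prime j<p)
  ... | Bézout.+- x y 1+yj≡xp = record
    { integral = ℕ∈ j
    ; y∈       = ∈-neg (ℕ∈ y)
    ; xy≡1     = ∈-resp (sym (combine₁ (- 1ℚ) (cast 1 y x 1+yj≡xp) (identity (fromℕ j) (fromℕ y) (fromℕ x) P))) (P∈ ∈* ∈-neg (ℕ∈ x))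
    }
    where
    cast : ∀ l y x → l ℕ.+ y ℕ.* j ≡ x ℕ.* p → fromℕ l + fromℕ y * fromℕ j ≡ fromℕ x * P
    cast l y x e = trans (trans (cong (_+_ (fromℕ l)) (sym (fromℕ-* y j))) (sym (fromℕ-+ l (y ℕ.* j))))
      (trans (cong fromℕ e) (fromℕ-* x p))
    identity : ∀ j y x P → j * - y - 1ℚ ≡ P * - x + (- 1ℚ) * (1ℚ + y * j - x * P)
    identity = solve-∀ ℚ-ring
  ... | Bézout.-+ x y 1+xp≡yj = record
    { integral = ℕ∈ j
    ; y∈       = ℕ∈ y
    ; xy≡1     = ∈-resp (sym (combine₁ (- 1ℚ) (cast 1 x y 1+xp≡yj) (identity (fromℕ j) (fromℕ y) (fromℕ x) P))) (P∈ ∈* ℕ∈ x)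
    }
    where
    cast : ∀ l x y → l ℕ.+ x ℕ.* p ≡ y ℕ.* j → fromℕ l + fromℕ x * P ≡ fromℕ y * fromℕ j
    cast l x y e = trans (trans (cong (_+_ (fromℕ l)) (sym (fromℕ-* x p))) (sym (fromℕ-+ l (x ℕ.* p))))
      (trans (cong fromℕ e) (fromℕ-* y j))
    identity : ∀ j y x P → j * y - 1ℚ ≡ P * x + (- 1ℚ) * (1ℚ + x * P - y * j)
    identity = solve-∀ ℚ-ring

  -- 1 / (1 + p d) is the p-adic integer 1 - p d + (p d)² - ⋯

  geometric : ℤ → ℕ → ℤ
  geometric d zero    = + 0
  geometric d (suc n) = geometric d n ℤ.+ + (p ℕ.^ n) ℤ.* (ℤ.- d) ℤ.^ n

  geometric-inverse : ∀ d n → (+ 1 ℤ.+ + p ℤ.* d) ℤ.* geometric d n ≡ + 1 ℤ.- + (p ℕ.^ n) ℤ.* (ℤ.- d) ℤ.^ n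
  geometric-inverse d zero    = ℤ.*-zeroʳ (+ 1 ℤ.+ + p ℤ.* d)
  geometric-inverse d (suc n) = begin
    (+ 1 ℤ.+ + p ℤ.* d) ℤ.* (geometric d n ℤ.+ Q ℤ.* e)
      ≡⟨ ℤ.*-distribˡ-+ (+ 1 ℤ.+ + p ℤ.* d) (geometric d n) (Q ℤ.* e) ⟩
    (+ 1 ℤ.+ + p ℤ.* d) ℤ.* geometric d n ℤ.+ (+ 1 ℤ.+ + p ℤ.* d) ℤ.* (Q ℤ.* e)
      ≡⟨ cong (ℤ._+ (+ 1 ℤ.+ + p ℤ.* d) ℤ.* (Q ℤ.* e)) (geometric-inverse d n) ⟩
    (+ 1 ℤ.- Q ℤ.* e) ℤ.+ (+ 1 ℤ.+ + p ℤ.* d) ℤ.* (Q ℤ.* e)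
      ≡⟨ identity (+ p) d Q e ⟩
    + 1 ℤ.- (+ p ℤ.* Q) ℤ.* (ℤ.- d ℤ.* e)
      ≡⟨ cong (λ R → + 1 ℤ.- R ℤ.* (ℤ.- d ℤ.* e)) (sym (ℤ.pos-* p (p ℕ.^ n))) ⟩
    + 1 ℤ.- + (p ℕ.^ suc n) ℤ.* (ℤ.- d ℤ.* e) ∎
    where
    Q e : ℤ
    Q = + (p ℕ.^ n)
    e = (ℤ.- d) ℤ.^ n
    identity : ∀ p d Q e → (+ 1 ℤ.- Q ℤ.* e) ℤ.+ (+ 1 ℤ.+ p ℤ.* d) ℤ.* (Q ℤ.* e) ≡ + 1 ℤ.- (p ℤ.* Q) ℤ.* (ℤ.- d ℤ.* e)
    identity = ℤ-Solver.solve-∀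

  -- The quotient of x by p^m is z / (1 + pd), whose residues are `z * geometric d n`. With
  -- denominators cleared in ℤ, the error at level n is a multiple of the first omitted power p^n.
  ∈𝔭⇒∈ℤₚ : ∀ {x m} → x ∈𝔭^ m → x ∈[ p ^ m ]ℤₚ
  ∈𝔭⇒∈ℤₚ {x} {m} ⟪ (d , refl) , (z , refl) , x-eq ⟫ = quotient , λ n → ℤ.divides (↥ x ℤ.* ℤ.- e n) (begin
    ↧ x ℤ.* (pᵐ ℤ.* (z ℤ.* geometric d n)) ℤ.- ↥ x
      ≡⟨ regroup (↧ x) pᵐ z (geometric d n) (↥ x) ⟩
    ↧ x ℤ.* (pᵐ ℤ.* z) ℤ.* geometric d n ℤ.- ↥ x
      ≡⟨ cong (λ y → y ℤ.* geometric d n ℤ.- ↥ x) (sym cleared) ⟩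
    ↥ x ℤ.* (+ 1 ℤ.+ + p ℤ.* d) ℤ.* geometric d n ℤ.- ↥ x
      ≡⟨ cong (ℤ._- ↥ x) (ℤ.*-assoc (↥ x) _ _) ⟩
    ↥ x ℤ.* ((+ 1 ℤ.+ + p ℤ.* d) ℤ.* geometric d n) ℤ.- ↥ x
      ≡⟨ cong (λ y → ↥ x ℤ.* y ℤ.- ↥ x) (geometric-inverse d n) ⟩
    ↥ x ℤ.* (+ 1 ℤ.- + (p ℕ.^ n) ℤ.* e n) ℤ.- ↥ x
      ≡⟨ expand (↥ x) (+ (p ℕ.^ n)) (e n) ⟩
    ↥ x ℤ.* ℤ.- e n ℤ.* + (p ℕ.^ n) ∎)
    where
    pᵐ : ℤ
    pᵐ = + (p ℕ.^ m)
    e : ℕ → ℤ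
    e n = (ℤ.- d) ℤ.^ n
    regroup : ∀ a b c d e → a ℤ.* (b ℤ.* (c ℤ.* d)) ℤ.- e ≡ a ℤ.* (b ℤ.* c) ℤ.* d ℤ.- e
    regroup = ℤ-Solver.solve-∀
    expand : ∀ x Q e → x ℤ.* (+ 1 ℤ.- Q ℤ.* e) ℤ.- x ≡ x ℤ.* ℤ.- e ℤ.* Q
    expand = ℤ-Solver.solve-∀
    quotient : ℤₚ p
    quotient .residue n  = z ℤ.* geometric d n
    quotient .coherent n = ℤ.divides (z ℤ.* e n) (difference z (geometric d n) (+ (p ℕ.^ n)) (e n))
      where
      difference : ∀ z g Q e → z ℤ.* (g ℤ.+ Q ℤ.* e) ℤ.- z ℤ.* g ≡ z ℤ.* e ℤ.* Q
      difference = ℤ-Solver.solve-∀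
    fromℤ-1+pd : fromℤ (+ 1 ℤ.+ + p ℤ.* d) ≡ 1ℚ + P * fromℤ d
    fromℤ-1+pd = trans (fromℤ-+ (+ 1) (+ p ℤ.* d)) (cong (_+_ 1ℚ) (fromℤ-* (+ p) d))
    fromℤ-pᵐz : fromℤ (pᵐ ℤ.* z) ≡ P ^ m * fromℤ z
    fromℤ-pᵐz = trans (fromℤ-* pᵐ z) (cong (_* fromℤ z) (fromℕ-^ p m))
    commute : ∀ x b c → x * b * c ≡ b * (x * c)
    commute = solve-∀ ℚ-ring
    cleared : ↥ x ℤ.* (+ 1 ℤ.+ + p ℤ.* d) ≡ ↧ x ℤ.* (pᵐ ℤ.* z)
    cleared = fromℤ-injective (begin
      fromℤ (↥ x ℤ.* (+ 1 ℤ.+ + p ℤ.* d))           ≡⟨ fromℤ-* (↥ x) (+ 1 ℤ.+ + p ℤ.* d) ⟩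
      fromℤ (↥ x) * fromℤ (+ 1 ℤ.+ + p ℤ.* d)       ≡⟨ cong₂ _*_ (sym (x*↧x≡↥x x)) fromℤ-1+pd ⟩
      x * fromℤ (↧ x) * (1ℚ + P * fromℤ d)           ≡⟨ commute x (fromℤ (↧ x)) (1ℚ + P * fromℤ d) ⟩
      fromℤ (↧ x) * (x * (1ℚ + P * fromℤ d))         ≡⟨ cong (_*_ (fromℤ (↧ x))) (trans x-eq (sym fromℤ-pᵐz)) ⟩
      fromℤ (↧ x) * fromℤ (pᵐ ℤ.* z)                 ≡⟨ sym (fromℤ-* (↧ x) (pᵐ ℤ.* z)) ⟩
      fromℤ (↧ x ℤ.* (pᵐ ℤ.* z))                     ∎)

-- Factorials and exponential series

!*1/! : ∀ n → fromℕ (n !) * 1/ n ! ≡ 1ℚ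
!*1/! n = trans (cong (_*_ (fromℕ (n !))) (1/n≡n⁻¹ (n !) {{n ℕ.!≢0}})) (*-⁻¹ (fromℕ-≢0 (n !) {{n ℕ.!≢0}}))

suc*1/suc! : ∀ n → fromℕ (suc n) * 1/ suc n ! ≡ 1/ n !
suc*1/suc! n = *-cancelˡ (fromℕ (suc n) * 1/ suc n !) (1/ n !) (fromℕ-≢0 (n !) {{n ℕ.!≢0}}) (begin
  fromℕ (n !) * (fromℕ (suc n) * 1/ suc n !)   ≡⟨ regroup (fromℕ (n !)) (fromℕ (suc n)) (1/ suc n !) ⟩
  fromℕ (suc n) * fromℕ (n !) * 1/ suc n !     ≡⟨ cong (_* 1/ suc n !) (sym (fromℕ-* (suc n) (n !))) ⟩
  fromℕ (suc n !) * 1/ suc n !                 ≡⟨ trans (!*1/! (suc n)) (sym (!*1/! n)) ⟩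
  fromℕ (n !) * 1/ n !                         ∎)
  where
  regroup : ∀ x y z → x * (y * z) ≡ y * x * z
  regroup = solve-∀ ℚ-ring

suc*exp : ∀ x n → fromℕ (suc n) * exp[ x t] (suc n) ≡ x * exp[ x t] n
suc*exp x n = trans (regroup (fromℕ (suc n)) x (x ^ n) (1/ suc n !)) (cong (λ z → x * (x ^ n * z)) (suc*1/suc! n))
  where
  regroup : ∀ N x X z → N * (x * X * z) ≡ x * (X * (N * z))
  regroup = solve-∀ ℚ-ring

-- This is e^{xt} e^t = e^{(x+1)t} by coefficients. Splitting n + 1 = k + (n + 1 - k) is Leibniz'
-- rule, so both sides obey f′ = (x + 1) f.
exp-binomial : ∀ x n → ∑[k≤ n ] (λ k → exp[ x t] k * 1/ (n ∸ k) !) ≡ exp[ x + 1ℚ t] n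
exp-binomial x zero    = refl
exp-binomial x (suc n) = *-cancelˡ (∑[k≤ suc n ] s) (exp[ x + 1ℚ t] (suc n)) (fromℕ-≢0 (suc n)) (begin
  N′ * ∑[k≤ suc n ] s
    ≡⟨ sym (∑-* (suc n) N′ s) ⟩
  ∑[k≤ suc n ] (λ k → N′ * s k)
    ≡⟨ ∑-cong (suc n) (λ k _ → divide N′ (fromℕ k) (s k)) ⟩
  ∑[k≤ suc n ] (λ k → fromℕ k * s k + (N′ - fromℕ k) * s k)
    ≡⟨ ∑-+ (suc n) (λ k → fromℕ k * s k) (λ k → (N′ - fromℕ k) * s k) ⟩
  ∑[k≤ suc n ] (λ k → fromℕ k * s k) + ∑[k≤ suc n ] (λ k → (N′ - fromℕ k) * s k)
    ≡⟨ cong₂ _+_ first second ⟩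
  x * S + S
    ≡⟨ factor x S ⟩
  (x + 1ℚ) * S
    ≡⟨ cong (_*_ (x + 1ℚ)) (exp-binomial x n) ⟩
  (x + 1ℚ) * exp[ x + 1ℚ t] n
    ≡⟨ sym (suc*exp (x + 1ℚ) n) ⟩
  N′ * exp[ x + 1ℚ t] (suc n) ∎)
  where
  N′ S : ℚ
  s : ℕ → ℚ
  N′ = fromℕ (suc n)
  S = ∑[k≤ n ] (λ k → exp[ x t] k * 1/ (n ∸ k) !)
  s k = exp[ x t] k * 1/ (suc n ∸ k) !
  divide : ∀ N k s → N * s ≡ k * s + (N - k) * s
  divide = solve-∀ ℚ-ring
  factor : ∀ x S → x * S + S ≡ (x + 1ℚ) * S
  factor = solve-∀ ℚ-ring
  drop-zero : ∀ z y → 0ℚ * z + y ≡ y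
  drop-zero = solve-∀ ℚ-ring
  drop-last : ∀ y N z → y + (N - N) * z ≡ y
  drop-last = solve-∀ ℚ-ring
  swap : ∀ N e z → N * (e * z) ≡ e * (N * z)
  swap = solve-∀ ℚ-ring
  first-summand : ∀ k → fromℕ (suc k) * s (suc k) ≡ x * (exp[ x t] k * 1/ (n ∸ k) !)
  first-summand k = trans (sym (*-assoc (fromℕ (suc k)) (exp[ x t] (suc k)) (1/ (n ∸ k) !)))
    (trans (cong (_* 1/ (n ∸ k) !) (suc*exp x k)) (*-assoc x (exp[ x t] k) (1/ (n ∸ k) !)))
  first : ∑[k≤ suc n ] (λ k → fromℕ k * s k) ≡ x * S
  first = trans (drop-zero (s 0) (∑[k≤ n ] (λ k → fromℕ (suc k) * s (suc k))))
    (trans (∑-cong n (λ k _ → first-summand k)) (∑-* n x (λ k → exp[ x t] k * 1/ (n ∸ k) !)))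
  second-summand : ∀ k → k ℕ.≤ n → (N′ - fromℕ k) * s k ≡ exp[ x t] k * 1/ (n ∸ k) !
  second-summand k k≤n = begin
    (N′ - fromℕ k) * (exp[ x t] k * 1/ (suc n ∸ k) !)
      ≡⟨ cong (_* s k) (sym (fromℕ-∸ (ℕ.m≤n⇒m≤1+n k≤n))) ⟩
    fromℕ (suc n ∸ k) * (exp[ x t] k * 1/ (suc n ∸ k) !)
      ≡⟨ cong (λ l → fromℕ l * (exp[ x t] k * 1/ l !)) (ℕ.+-∸-assoc 1 k≤n) ⟩
    fromℕ (suc (n ∸ k)) * (exp[ x t] k * 1/ suc (n ∸ k) !)
      ≡⟨ swap (fromℕ (suc (n ∸ k))) (exp[ x t] k) (1/ suc (n ∸ k) !) ⟩
    exp[ x t] k * (fromℕ (suc (n ∸ k)) * 1/ suc (n ∸ k) !)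
      ≡⟨ cong (_*_ (exp[ x t] k)) (suc*1/suc! (n ∸ k)) ⟩
    exp[ x t] k * 1/ (n ∸ k) ! ∎
  second : ∑[k≤ suc n ] (λ k → (N′ - fromℕ k) * s k) ≡ S
  second = trans (∑-snoc n (λ k → (N′ - fromℕ k) * s k))
    (trans (drop-last (∑[k≤ n ] (λ k → (N′ - fromℕ k) * s k)) N′ (s (suc n))) (∑-cong n second-summand))

-- Euler polynomials

const-*ₛ : ∀ c f n → (const c *ₛ f) n ≡ c * f n
const-*ₛ c f zero    = ∑-zero (λ k → const c k * f (0 ∸ k))
const-*ₛ c f (suc n) = trans (cong (_+_ (c * f (suc n))) (∑-0 n (λ k _ → *-zeroˡ (f (n ∸ k))))) (+-identityʳ (c * f (suc n)))

*ₛ-const : ∀ f c n → (f *ₛ const c) n ≡ f n * c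
*ₛ-const f c n = begin
  ∑[k≤ n ] (λ k → f k * const c (n ∸ k))              ≡⟨ sym (∑-reverse n (λ k → f k * const c (n ∸ k))) ⟩
  ∑[k≤ n ] (λ k → f (n ∸ k) * const c (n ∸ (n ∸ k)))  ≡⟨ ∑-cong n swap ⟩
  ∑[k≤ n ] (λ k → const c k * f (n ∸ k))              ≡⟨ const-*ₛ c f n ⟩
  c * f n                                             ≡⟨ *-comm c (f n) ⟩
  f n * c                                             ∎
  where
  swap : ∀ k → k ℕ.≤ n → f (n ∸ k) * const c (n ∸ (n ∸ k)) ≡ const c k * f (n ∸ k)
  swap k k≤n = trans (cong (λ l → f (n ∸ k) * const c l) (ℕ.m∸[m∸n]≡n k≤n)) (*-comm (f (n ∸ k)) (const c k))

1^n≡1 : ∀ n → 1ℚ ^ n ≡ 1ℚ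
1^n≡1 zero    = refl
1^n≡1 (suc n) = trans (*-identityˡ (1ℚ ^ n)) (1^n≡1 n)

-- (eᵗ + 1) f = r, coefficientwise

_Solves_ : Series → Series → Set
f Solves r = ∀ n → ∑[k≤ n ] (λ k → f k * 1/ (n ∸ k) !) + f n ≡ r n

opaque

  -- Sealed so that the long division never unfolds; later arguments see the series only through the
  -- equation `euler-solves`.
  euler : ℚ → Series
  euler x = (const (fromℕ 2) *ₛ exp[ x t]) ÷ₛ (exp[ 1ℚ t] +ₛ const 1ℚ)

  eulerPolynomial≡ : ∀ n x → eulerPolynomial n x ≡ fromℕ (n !) * euler x n
  eulerPolynomial≡ n x = refl

  euler-solves : ∀ x → euler x Solves (λ n → fromℕ 2 * exp[ x t] n)
  euler-solves x n = begin
    ∑[k≤ n ] (λ k → euler x k * 1/ (n ∸ k) !) + euler x n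
      ≡⟨ cong₂ _+_ (∑-cong n λ k _ → cong (_*_ (euler x k)) (sym (exp-1 (n ∸ k))))
           (sym (trans (*ₛ-const (euler x) 1ℚ n) (*-identityʳ (euler x n)))) ⟩
    (euler x *ₛ exp[ 1ℚ t]) n + (euler x *ₛ const 1ℚ) n
      ≡⟨ sym (∑-+ n (λ k → euler x k * exp[ 1ℚ t] (n ∸ k)) (λ k → euler x k * const 1ℚ (n ∸ k))) ⟩
    ∑[k≤ n ] (λ k → euler x k * exp[ 1ℚ t] (n ∸ k) + euler x k * const 1ℚ (n ∸ k))
      ≡⟨ ∑-cong n (λ k _ → sym (*-distribˡ-+ (euler x k) (exp[ 1ℚ t] (n ∸ k)) (const 1ℚ (n ∸ k)))) ⟩
    (euler x *ₛ (exp[ 1ℚ t] +ₛ const 1ℚ)) n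
      ≡⟨ ÷ₛ-*ₛ (const (fromℕ 2) *ₛ exp[ x t]) (exp[ 1ℚ t] +ₛ const 1ℚ) n ⟩
    (const (fromℕ 2) *ₛ exp[ x t]) n
      ≡⟨ const-*ₛ (fromℕ 2) exp[ x t] n ⟩
    fromℕ 2 * exp[ x t] n ∎
    where
    exp-1 : ∀ k → exp[ 1ℚ t] k ≡ 1/ k !
    exp-1 k = trans (cong (_* 1/ k !) (1^n≡1 k)) (*-identityˡ (1/ k !))

module _ (f r : Series) (f-solves-r : f Solves r) where

  solution-zero : f 0 ≡ ½ * r 0
  solution-zero = sym (trans (cong (_*_ ½) (sym (f-solves-r 0))) (identity (f 0)))
    where
    identity : ∀ x → ½ * (x * 1ℚ + 0ℚ + x) ≡ x
    identity = solve-∀ ℚ-ring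

  -- The constant term of eᵗ + 1 is 2, so the equation determines each coefficient from the earlier
  -- ones, at the price of one division by 2.
  solution-suc : ∀ n → f (suc n) ≡ ½ * (r (suc n) - ∑[k≤ n ] (λ k → f k * 1/ (suc n ∸ k) !))
  solution-suc n = sym (begin
    ½ * (r (suc n) - S)
      ≡⟨ cong (λ z → ½ * (z - S)) (sym (f-solves-r (suc n))) ⟩
    ½ * (∑[k≤ suc n ] (λ k → f k * 1/ (suc n ∸ k) !) + f (suc n) - S)
      ≡⟨ cong (λ z → ½ * (z + f (suc n) - S)) (∑-snoc n (λ k → f k * 1/ (suc n ∸ k) !)) ⟩
    ½ * (S + f (suc n) * 1/ (n ∸ n) ! + f (suc n) - S)
      ≡⟨ cong (λ l → ½ * (S + f (suc n) * 1/ l ! + f (suc n) - S)) (ℕ.n∸n≡0 n) ⟩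
    ½ * (S + f (suc n) * 1ℚ + f (suc n) - S)
      ≡⟨ identity S (f (suc n)) ⟩
    f (suc n) ∎)
    where
    S : ℚ
    S = ∑[k≤ n ] (λ k → f k * 1/ (suc n ∸ k) !)
    identity : ∀ S x → ½ * (S + x * 1ℚ + x - S) ≡ x
    identity = solve-∀ ℚ-ring

solves-0 : ∀ f → f Solves (λ _ → 0ℚ) → ∀ n → f n ≡ 0ℚ
solves-0 f f-solves = <-rec (λ n → f n ≡ 0ℚ) step
  where
  step : ∀ n → (∀ {k} → k ℕ.< n → f k ≡ 0ℚ) → f n ≡ 0ℚ
  step zero    _    = trans (solution-zero f (λ _ → 0ℚ) f-solves) refl
  step (suc n) f<≡0 = trans (solution-suc f (λ _ → 0ℚ) f-solves n) (cong (λ z → ½ * (0ℚ - z))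
    (∑-0 n λ k k≤n → x≡0⇒x*y≡0 (1/ (suc n ∸ k) !) (f<≡0 (s≤s k≤n))))

-- Multiplied by eᵗ + 1, both sides become 2 e^{xt} (1 + eᵗ). Hence their difference `φ` is
-- annihilated by eᵗ + 1 and vanishes by uniqueness.
euler-functional : ∀ x n → euler x n + euler (x + 1ℚ) n ≡ fromℕ 2 * exp[ x t] n
euler-functional x n = trans (separate (euler x n + euler (x + 1ℚ) n) (fromℕ 2 * exp[ x t] n))
  (trans (cong (_+ fromℕ 2 * exp[ x t] n) (solves-0 φ φ-solves n)) (+-identityˡ (fromℕ 2 * exp[ x t] n)))
  where
  separate : ∀ a b → a ≡ a - b + b
  separate = solve-∀ ℚ-ring
  φ : Series
  φ k = euler x k + euler (x + 1ℚ) k - fromℕ 2 * exp[ x t] k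
  distribute : ∀ a b e h → (a + b - fromℕ 2 * e) * h ≡ a * h + b * h - fromℕ 2 * (e * h)
  distribute = solve-∀ ℚ-ring
  regroup : ∀ A a B b E e → A + B - fromℕ 2 * E + (a + b - fromℕ 2 * e) ≡ (A + a) + (B + b) - fromℕ 2 * E - fromℕ 2 * e
  regroup = solve-∀ ℚ-ring
  cancel : ∀ e e′ → fromℕ 2 * e + fromℕ 2 * e′ - fromℕ 2 * e′ - fromℕ 2 * e ≡ 0ℚ
  cancel = solve-∀ ℚ-ring
  φ-solves : φ Solves (λ _ → 0ℚ)
  φ-solves n = begin
    ∑[k≤ n ] (λ k → φ k * h k) + φ n
      ≡⟨ cong (_+ φ n) (trans (∑-cong n λ k _ → distribute (euler x k) (euler (x + 1ℚ) k) (exp[ x t] k) (h k)) sums) ⟩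
    A + B - fromℕ 2 * E + φ n
      ≡⟨ regroup A (euler x n) B (euler (x + 1ℚ) n) E (exp[ x t] n) ⟩
    (A + euler x n) + (B + euler (x + 1ℚ) n) - fromℕ 2 * E - fromℕ 2 * exp[ x t] n
      ≡⟨ cong₂ (λ u v → u - fromℕ 2 * v - fromℕ 2 * exp[ x t] n)
           (cong₂ _+_ (euler-solves x n) (euler-solves (x + 1ℚ) n)) (exp-binomial x n) ⟩
    fromℕ 2 * exp[ x t] n + fromℕ 2 * exp[ x + 1ℚ t] n - fromℕ 2 * exp[ x + 1ℚ t] n - fromℕ 2 * exp[ x t] n
      ≡⟨ cancel (exp[ x t] n) (exp[ x + 1ℚ t] n) ⟩
    0ℚ ∎
    where
    h : ℕ → ℚ
    h k = 1/ (n ∸ k) !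
    A B E : ℚ
    A = ∑[k≤ n ] (λ k → euler x k * h k)
    B = ∑[k≤ n ] (λ k → euler (x + 1ℚ) k * h k)
    E = ∑[k≤ n ] (λ k → exp[ x t] k * h k)
    sums : ∑[k≤ n ] (λ k → euler x k * h k + euler (x + 1ℚ) k * h k - fromℕ 2 * (exp[ x t] k * h k)) ≡ A + B - fromℕ 2 * E
    sums = trans (∑-- n (λ k → euler x k * h k + euler (x + 1ℚ) k * h k) (λ k → fromℕ 2 * (exp[ x t] k * h k)))
      (cong₂ _-_ (∑-+ n (λ k → euler x k * h k) (λ k → euler (x + 1ℚ) k * h k)) (∑-* n (fromℕ 2) (λ k → exp[ x t] k * h k)))

-- Residues modulo the prime p = 3 + m, with m the index of the Euler polynomial

module Residues (m : ℕ) (p-prime : Prime (3 ℕ.+ m)) where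

  p : ℕ
  p = 3 ℕ.+ m

  open Ideals p public

  unit-suc : ∀ {j} → suc j ℕ.< p → Unit (fromℕ (suc j))
  unit-suc 1+j<p = unit-ℕ p-prime 1+j<p

  unit-! : ∀ {n} → n ℕ.< p → Unit (fromℕ (n !))
  unit-! {zero}  _     = unit-1
  unit-! {suc n} 1+n<p = subst Unit (sym (fromℕ-* (suc n) (n !))) (unit-* (unit-suc 1+n<p) (unit-! (ℕ.<-trans (ℕ.n<1+n n) 1+n<p)))

  1/!∈ : ∀ {n} → n ℕ.< p → 1/ n ! ∈𝔭^ 0
  1/!∈ {n} n<p = ∈-resp (sym (1/n≡n⁻¹ (n !) {{n ℕ.!≢0}})) (unit-⁻¹ (unit-! n<p))

  ½∈ : ½ ∈𝔭^ 0
  ½∈ = unit-⁻¹ (unit-suc {1} (s≤s (s≤s (s≤s z≤n))))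

  -- Adding the reversed sum doubles the sum, and 2 is invertible mod p. Together with `∏-symmetric`
  -- this turns weights that are antisymmetric mod p into an additional factor p.
  ∑-antisymmetric : ∀ {e} k f → (∀ i → i ℕ.≤ k → f i + f (k ∸ i) ∈𝔭^ e) → ∑[k≤ k ] f ∈𝔭^ e
  ∑-antisymmetric k f f∈ = ∈-resp (begin
    ½ * ∑[k≤ k ] (λ i → f i + f (k ∸ i))            ≡⟨ cong (_*_ ½) (∑-+ k f (λ i → f (k ∸ i))) ⟩
    ½ * (∑[k≤ k ] f + ∑[k≤ k ] (λ i → f (k ∸ i)))   ≡⟨ cong (λ S → ½ * (∑[k≤ k ] f + S)) (∑-reverse k f) ⟩
    ½ * (∑[k≤ k ] f + ∑[k≤ k ] f)                    ≡⟨ halve (∑[k≤ k ] f) ⟩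
    ∑[k≤ k ] f                                       ∎) (½∈ ∈* ∈-∑ k f∈)
    where
    halve : ∀ x → ½ * (x + x) ≡ x
    halve = solve-∀ ℚ-ring

  even-^-cong∈ : ∀ {x y} k → x ∈𝔭^ 0 → y ∈𝔭^ 0 → x + y ∈𝔭^ 1 → x ^ (2 ℕ.* k) - y ^ (2 ℕ.* k) ∈𝔭^ 1
  even-^-cong∈ {x} {y} k x∈ y∈ x≡-y = ∈-resp (cong₂ _-_ (^-assocʳ x 2 k) (^-assocʳ y 2 k))
    (^-cong∈ k (∈-^ 2 x∈) (∈-^ 2 y∈) (∈-resp (identity x y) ((x∈ ∈- y∈) ∈* x≡-y)))
    where
    identity : ∀ x y → (x - y) * (x + y) ≡ x * (x * 1ℚ) - y * (y * 1ℚ)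
    identity = solve-∀ ℚ-ring

  -- Fermat's little theorem, from the binomial expansion of (x + 1)ᵖ / p!

  frobenius-suc : ∀ {x} → x ∈𝔭^ 0 → (x + 1ℚ) ^ p - x ^ p - 1ℚ ∈𝔭^ 1
  frobenius-suc {x} x∈ = ∈-resp (sym (combine₂ (- p!) expansion (- (Y - X - 1ℚ)) (!*1/! p) (identity p! (1/ p !) middle X Y)))
    (p!∈ ∈* ∈-∑ (suc m) middle∈)
    where
    s : ℕ → ℚ
    s k = exp[ x t] k * 1/ (p ∸ k) !
    p! middle X Y : ℚ
    p! = fromℕ (p !)
    middle = ∑[k≤ suc m ] (s ∘ suc)
    X = x ^ p
    Y = (x + 1ℚ) ^ p
    p!∈ : p! ∈𝔭^ 1
    p!∈ = ∈-resp (sym (fromℕ-* p ((2 ℕ.+ m) !))) (P∈ ∈* ℕ∈ ((2 ℕ.+ m) !))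
    -- For the middle indices both factorials in the denominator are below p!, hence units; the
    -- factor p! then makes these terms divisible by p.
    middle∈ : ∀ k → k ℕ.≤ suc m → s (suc k) ∈𝔭^ 0
    middle∈ k k≤1+m = ∈-^ (suc k) x∈ ∈* 1/!∈ (s≤s (s≤s k≤1+m)) ∈* 1/!∈ (s≤s (ℕ.m∸n≤m (2 ℕ.+ m) k))
    expansion : 1ℚ * 1/ p ! * 1ℚ + (middle + X * 1/ p ! * 1ℚ) ≡ Y * 1/ p !
    expansion = trans (cong₂ (λ a b → a + (middle + b)) (commute (1/ p !))
        (cong (λ k → X * 1/ p ! * 1/ k !) (sym (ℕ.n∸n≡0 m))))
      (trans (cong (_+_ (s 0)) (sym (∑-snoc (suc m) (s ∘ suc)))) (exp-binomial x p))
      where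
      commute : ∀ i → 1ℚ * i * 1ℚ ≡ 1ℚ * 1ℚ * i
      commute = solve-∀ ℚ-ring
    identity : ∀ p! i M X Y → Y - X - 1ℚ ≡ p! * M + (- p!) * (1ℚ * i * 1ℚ + (M + X * i * 1ℚ) - Y * i) + (- (Y - X - 1ℚ)) * (p! * i - 1ℚ)
    identity = solve-∀ ℚ-ring

  frobenius : ∀ j → fromℕ j ^ p - fromℕ j ∈𝔭^ 1
  frobenius zero    = ∈-resp (sym (cong (_- 0ℚ) (*-zeroˡ (0ℚ ^ (2 ℕ.+ m))))) 0∈
  frobenius (suc j) = subst (λ x → x ^ p - x ∈𝔭^ 1) (sym (fromℕ-suc j))
    (∈-resp (identity (fromℕ j) (fromℕ j ^ p) ((fromℕ j + 1ℚ) ^ p)) (frobenius-suc (ℕ∈ j) ∈+ frobenius j))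
    where
    identity : ∀ x X Y → Y - X - 1ℚ + (X - x) ≡ Y - (x + 1ℚ)
    identity = solve-∀ ℚ-ring

  -- As m + 2 = p - 1, the power is J^(p-1). In this shape the congruence says that J^m is 1/J² mod
  -- p, which is how the Euler polynomial meets the recurrence for R.
  fermat : ∀ {j} → suc j ℕ.< p → let J = fromℕ (suc j) in J ^ m * (J * J) - 1ℚ ∈𝔭^ 1
  fermat {j} 1+j<p = unit-cancel (J ^ m * (J * J) - 1ℚ) (fromℕ-≢0 (suc j)) (unit-suc 1+j<p)
    (∈-resp (identity J (J ^ m)) (frobenius (suc j)))
    where
    J : ℚ
    J = fromℕ (suc j)
    identity : ∀ J X → J * (J * (J * X)) - J ≡ J * (X * (J * J) - 1ℚ)
    identity = solve-∀ ℚ-ring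

  -- Euler polynomials modulo p

  -- Below index p the recursion `solution-suc` involves only 2 and factorials prime to p as
  -- denominators, so it can be read modulo p; strong induction does the rest.
  euler-cong∈ : ∀ {x y} → x ∈𝔭^ 0 → y ∈𝔭^ 0 → x - y ∈𝔭^ 1 → ∀ n → n ℕ.< p → euler x n - euler y n ∈𝔭^ 1
  euler-cong∈ {x} {y} x∈ y∈ x≡y = <-rec (λ n → n ℕ.< p → euler x n - euler y n ∈𝔭^ 1) step
    where
    r : ℚ → Series
    r x n = fromℕ 2 * exp[ x t] n
    f : Series
    f k = euler x k - euler y k
    ∑-difference : ∀ n → ∑[k≤ n ] (λ k → euler x k * 1/ (suc n ∸ k) !) - ∑[k≤ n ] (λ k → euler y k * 1/ (suc n ∸ k) !)
      ≡ ∑[k≤ n ] (λ k → f k * 1/ (suc n ∸ k) !)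
    ∑-difference n = sym (trans (∑-cong n λ k _ → distrib (euler x k) (euler y k) (1/ (suc n ∸ k) !))
      (∑-- n (λ k → euler x k * 1/ (suc n ∸ k) !) (λ k → euler y k * 1/ (suc n ∸ k) !)))
      where
      distrib : ∀ a b h → (a - b) * h ≡ a * h - b * h
      distrib = solve-∀ ℚ-ring
    identity : ∀ X Y i S T → ½ * (fromℕ 2 * ((X - Y) * i) - (S - T)) ≡ ½ * (fromℕ 2 * (X * i) - S) - ½ * (fromℕ 2 * (Y * i) - T)
    identity = solve-∀ ℚ-ring
    step : ∀ n → (∀ {k} → k ℕ.< n → k ℕ.< p → f k ∈𝔭^ 1) → n ℕ.< p → f n ∈𝔭^ 1
    step zero _ 0<p = ∈-resp (sym (trans (cong₂ _-_ (solution-zero (euler x) (r x) (euler-solves x))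
      (solution-zero (euler y) (r y) (euler-solves y))) refl)) 0∈
    step (suc n) hypothesis 1+n<p = ∈-resp
      (trans (trans (cong (λ z → ½ * (fromℕ 2 * ((x ^ suc n - y ^ suc n) * 1/ suc n !) - z)) (sym (∑-difference n)))
          (identity (x ^ suc n) (y ^ suc n) (1/ suc n !) (∑[k≤ n ] (λ k → euler x k * 1/ (suc n ∸ k) !))
            (∑[k≤ n ] (λ k → euler y k * 1/ (suc n ∸ k) !))))
        (sym (cong₂ _-_ (solution-suc (euler x) (r x) (euler-solves x) n) (solution-suc (euler y) (r y) (euler-solves y) n))))
      (½∈ ∈* (ℕ∈ 2 ∈* (^-cong∈ (suc n) x∈ y∈ x≡y ∈* 1/!∈ 1+n<p) ∈- ∈-∑ n λ k k≤n →
        hypothesis (s≤s k≤n) (ℕ.≤-<-trans (ℕ.m≤n⇒m≤1+n k≤n) 1+n<p) ∈* 1/!∈ (ℕ.≤-<-trans (ℕ.m∸n≤m (suc n) k) 1+n<p)))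

  !*euler-functional : ∀ x → fromℕ (m !) * euler (x + 1ℚ) m + fromℕ (m !) * euler x m ≡ fromℕ 2 * x ^ m
  !*euler-functional x = combine₂ (fromℕ (m !)) (euler-functional x m) (fromℕ 2 * x ^ m) (!*1/! m)
    (identity (fromℕ (m !)) (euler (x + 1ℚ) m) (euler x m) (x ^ m) (1/ m !))
    where
    identity : ∀ F b a X i → F * b + F * a ≡ fromℕ 2 * X + F * (a + b - fromℕ 2 * (X * i)) + fromℕ 2 * X * (F * i - 1ℚ)
    identity = solve-∀ ℚ-ring

  module _ (r : ℕ) (m≡2r : m ≡ 2 ℕ.* suc r) where

    m<p : m ℕ.< p
    m<p = s≤s (ℕ.m≤n+m m 2)

    -- The function j ↦ E_m(j + 1) - E_m(p - j) changes sign mod p at each step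
    -- and vanishes at j = (p - 1) / 2; at j = 0 it is E_m(1) - E_m(p) ≡ - 2 E_m(0).

    euler-0∈ : euler 0ℚ m ∈𝔭^ 1
    euler-0∈ = ∈-resp (halve (euler 0ℚ m)) (½∈ ∈* ∈-resp first (∈-neg (ε-0∈ ∈+ euler-cong∈ (ℕ∈ p) 0∈ P-0∈ m m<p)))
      where
      ε : ℕ → ℚ
      ε j = euler (fromℕ j + 1ℚ) m - euler (P - fromℕ j) m
      halve : ∀ x → ½ * (fromℕ 2 * x) ≡ x
      halve = solve-∀ ℚ-ring
      P-0∈ : P - 0ℚ ∈𝔭^ 1
      P-0∈ = P∈ ∈- 0∈
      -- `suc r` records that m is positive as well as even; hence E_m(1) = -E_m(0).
      0^m≡0 : 0ℚ ^ m ≡ 0ℚ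
      0^m≡0 = trans (cong (0ℚ ^_) m≡2r) (*-zeroˡ (0ℚ ^ (r ℕ.+ (suc r ℕ.+ 0))))
      first : - (ε 0 + (euler P m - euler 0ℚ m)) ≡ fromℕ 2 * euler 0ℚ m
      first = trans (cong (λ z → - (euler 1ℚ m - euler z m + (euler P m - euler 0ℚ m))) (+-identityʳ P))
        (combine₂ (- 1ℚ) (euler-functional 0ℚ m) (- (fromℕ 2 * 1/ m !)) 0^m≡0
          (identity (euler 1ℚ m) (euler P m) (euler 0ℚ m) (0ℚ ^ m) (1/ m !)))
        where
        identity : ∀ a b c X i → - (a - b + (b - c)) ≡ fromℕ 2 * c + (- 1ℚ) * (c + a - fromℕ 2 * (X * i)) + (- (fromℕ 2 * i)) * (X - 0ℚ)
        identity = solve-∀ ℚ-ring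
      ε-step : ∀ j → ε (suc j) + ε j ∈𝔭^ 1
      ε-step j = subst (λ x → euler (x + 1ℚ) m - euler (P - x) m + ε j ∈𝔭^ 1) (sym (fromℕ-suc j))
        (∈-resp (sym (combine₂ 1ℚ (euler-functional (x + 1ℚ) m) (- 1ℚ)
            (trans (cong (λ y → euler (P - (x + 1ℚ)) m + euler y m) (shift P x)) (euler-functional (P - (x + 1ℚ)) m))
            (identity (euler (x + 1ℚ + 1ℚ) m) (euler (P - (x + 1ℚ)) m) (euler (x + 1ℚ) m) (euler (P - x) m) ((x + 1ℚ) ^ m) ((P - (x + 1ℚ)) ^ m) (1/ m !))))
          (ℕ∈ 2 ∈* (subst (λ k → (x + 1ℚ) ^ k - (P - (x + 1ℚ)) ^ k ∈𝔭^ 1) (sym m≡2r)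
            (even-^-cong∈ (suc r) (ℕ∈ j ∈+ 1∈) (ℕ∈ p ∈- (ℕ∈ j ∈+ 1∈)) (∈-resp (sym (cancel P (x + 1ℚ))) P∈)) ∈* 1/!∈ m<p)))
        where
        x : ℚ
        x = fromℕ j
        shift : ∀ P x → P - x ≡ P - (x + 1ℚ) + 1ℚ
        shift = solve-∀ ℚ-ring
        cancel : ∀ P x → x + (P - x) ≡ P
        cancel = solve-∀ ℚ-ring
        identity : ∀ a b c d X Y i → a - b + (c - d) ≡ fromℕ 2 * ((X - Y) * i)
          + 1ℚ * (c + a - fromℕ 2 * (X * i)) + (- 1ℚ) * (b + d - fromℕ 2 * (Y * i))
        identity = solve-∀ ℚ-ring
      descend : ∀ j → ε j ∈𝔭^ 1 → ε 0 ∈𝔭^ 1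
      descend zero    ε∈ = ε∈
      descend (suc j) ε∈ = descend j (∈-resp (cancel (ε (suc j)) (ε j)) (ε-step j ∈- ε∈))
        where
        cancel : ∀ x y → x + y - x ≡ y
        cancel = solve-∀ ℚ-ring
      -- Here p = 2 (2 + r) + 1, so 2 + r is the midpoint, where the two arguments in `ε` coincide.
      middle : fromℕ (2 ℕ.+ r) + 1ℚ ≡ P - fromℕ (2 ℕ.+ r)
      middle = trans (cancel (fromℕ (2 ℕ.+ r))) (cong (_- fromℕ (2 ℕ.+ r))
        (trans (sym (trans (fromℕ-+ 1 (2 ℕ.* (2 ℕ.+ r))) (cong (_+_ 1ℚ) (fromℕ-* 2 (2 ℕ.+ r))))) (cong fromℕ p≡)))
        where
        cancel : ∀ x → x + 1ℚ ≡ 1ℚ + fromℕ 2 * x - x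
        cancel = solve-∀ ℚ-ring
        p≡ : suc (2 ℕ.* (2 ℕ.+ r)) ≡ p
        p≡ = cong suc (trans (ℕ.*-suc 2 (suc r)) (cong (2 ℕ.+_) (sym m≡2r)))
      ε-0∈ : ε 0 ∈𝔭^ 1
      ε-0∈ = descend (2 ℕ.+ r) (∈-resp (sym (trans (cong (λ x → euler x m - euler (P - fromℕ (2 ℕ.+ r)) m) middle)
        (+-inverseʳ (euler (P - fromℕ (2 ℕ.+ r)) m)))) 0∈)

    module _ {u : ℚ} (u∈ : u ∈𝔭^ 1) where

      -- By `eulerPolynomial≡` this is the polynomial value E_m(u - i).
      E : ℕ → ℚ
      E i = fromℕ (m !) * euler (u - fromℕ i) m

      E-zero : E 0 ∈𝔭^ 1
      E-zero = ∈-resp (cong (_*_ (fromℕ (m !))) (identity (euler (u - 0ℚ) m) (euler 0ℚ m)))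
        (ℕ∈ (m !) ∈* (euler-cong∈ (∈-weaken u∈ ∈- 0∈) 0∈ (∈-resp (simplify u) u∈) m m<p ∈+ euler-0∈))
        where
        identity : ∀ a b → a - b + b ≡ a
        identity = solve-∀ ℚ-ring
        simplify : ∀ u → u ≡ u - 0ℚ - 0ℚ
        simplify = solve-∀ ℚ-ring

      -- The functional equation gives 2 (u - I)^m, which is 2 I^m mod p because p divides u and m
      -- is even; `fermat` then replaces I^m by 1/I².
      E-step : ∀ i → suc i ℕ.< p → let I = fromℕ (suc i) in (E (suc i) + E i) * (I * I) - fromℕ 2 ∈𝔭^ 1
      E-step i 1+i<p = ∈-resp
        (sym (combine₁ (I * I) E-sum (identity (E (suc i) + E i) I ((u - I) ^ m) (I ^ m))))
        (ℕ∈ 2 ∈* (subst (λ k → (u - I) ^ k - I ^ k ∈𝔭^ 1) (sym m≡2r) (even-^-cong∈ (suc r) (∈-weaken u∈ ∈- ℕ∈ (suc i)) (ℕ∈ (suc i))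
          (∈-resp (sym (cancel u I)) u∈)) ∈* (ℕ∈ (suc i) ∈* ℕ∈ (suc i)) ∈+ fermat 1+i<p))
        where
        I : ℚ
        I = fromℕ (suc i)
        cancel : ∀ u I → u - I + I ≡ u
        cancel = solve-∀ ℚ-ring
        shift : ∀ u x → u - (x + 1ℚ) + 1ℚ ≡ u - x
        shift = solve-∀ ℚ-ring
        E-sum : E (suc i) + E i ≡ fromℕ 2 * (u - I) ^ m
        E-sum = trans (+-comm (E (suc i)) (E i)) (trans
          (cong (λ x → fromℕ (m !) * euler x m + E (suc i)) (sym (trans (cong (λ x → u - x + 1ℚ) (fromℕ-suc i)) (shift u (fromℕ i)))))
          (!*euler-functional (u - I)))
        identity : ∀ e I X Y → e * (I * I) - fromℕ 2 ≡ fromℕ 2 * ((X - Y) * (I * I) + (Y * (I * I) - 1ℚ)) + I * I * (e - fromℕ 2 * X)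
        identity = solve-∀ ℚ-ring

-- The terminating sums Rᵢ modulo p³

module Recurrence (m : ℕ) (p-prime : Prime (3 ℕ.+ m)) (r : ℕ) (m≡2r : m ≡ 2 ℕ.* suc r)
  (u : ℚ) (u∈ : Ideals._∈𝔭^_ (3 ℕ.+ m) u 1) where

  open Residues m p-prime

  -- This is (x + ωu)(x + ω²u), written so that it agrees definitionally with `D` of `Saalschütz` at
  -- s = - u and q = u * u.
  D : ℚ → ℚ
  D x = x * x + (- u) * x + u * u

  d : ℕ → ℚ
  d k = ∏[j< k ] (λ j → D (fromℕ (suc j)) ⁻¹)

  R-term : ℚ → ℕ → ℚ
  R-term x k = pochhammer (- x) k * pochhammer (x + 1ℚ - (u + u)) k * d k

  R : ℕ → ℚ
  R i = ∑[k≤ i ] (R-term (fromℕ i))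

  ∈-pochhammer : ∀ {x} → x ∈𝔭^ 0 → ∀ k → pochhammer x k ∈𝔭^ 0
  ∈-pochhammer x∈ zero    = 1∈
  ∈-pochhammer x∈ (suc k) = ∈-pochhammer x∈ k ∈* (x∈ ∈+ ℕ∈ k)

  unit-D : ∀ {j} → suc j ℕ.< p → Unit (D (fromℕ (suc j)))
  unit-D {j} 1+j<p = unit-≡ (unit-* (unit-suc 1+j<p) (unit-suc 1+j<p))
    (∈-resp (identity (fromℕ (suc j)) u) (u∈ ∈* (∈-weaken u∈ ∈- ℕ∈ (suc j))))
    where
    identity : ∀ J u → u * (u - J) ≡ J * J + (- u) * J + u * u - J * J
    identity = solve-∀ ℚ-ring

  d∈ : ∀ {k} → k ℕ.< p → d k ∈𝔭^ 0
  d∈ {k} k<p = ∈-∏ k λ j j<k → unit-⁻¹ (unit-D (ℕ.≤-<-trans j<k k<p))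

  module _ (D≢0 : ∀ j → D (fromℕ (suc j)) ≢ 0ℚ) where

    private
      module Step (i : ℕ) where

        I I′ θ : ℚ
        I  = fromℕ i
        I′ = fromℕ (suc i)
        θ  = fromℕ 2 * I′ * (I′ - u)

        c s : ℕ → ℚ
        c k = pochhammer (- I) k
        s k = pochhammer (I′ + 1ℚ - (u + u)) k

        -- For u = 0 the partial sums telescope and the remainders vanish.

        remainder : ℕ → ℚ
        remainder k = D I′ * ∑[k≤ k ] (λ k → R-term I′ k + R-term I k) - (fromℕ 2 * (u * u) + θ * (c k * s k) * d k)

        remainder-zero : remainder 0 ≡ 0ℚ
        remainder-zero = identity u I′
          where
          identity : ∀ u I → (I * I + (- u) * I + u * u) * (1ℚ * 1ℚ * 1ℚ + 1ℚ * 1ℚ * 1ℚ + 0ℚ)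
            - (fromℕ 2 * (u * u) + fromℕ 2 * I * (I - u) * (1ℚ * 1ℚ) * 1ℚ) ≡ 0ℚ
          identity = solve-∀ ℚ-ring

        -- The telescoping certificate θ c s d is exact up to a multiple of u³, and p divides u:
        -- each step contributes an element of p³.
        remainder-suc : ∀ k → let f = D (fromℕ (suc k)) ⁻¹ in
          remainder (suc k) ≡ remainder k + fromℕ 2 * (u * (u * u)) * ((I - fromℕ k) * (c k * s k) * (d k * f))
        remainder-suc k = begin
          D I′ * ∑[k≤ suc k ] (λ k → R-term I′ k + R-term I k) - (fromℕ 2 * (u * u) + θ * (c (suc k) * s (suc k)) * d (suc k))
            ≡⟨ cong (λ S → D I′ * S - (fromℕ 2 * (u * u) + θ * (c (suc k) * s (suc k)) * d (suc k)))
                 (∑-snoc k (λ k → R-term I′ k + R-term I k)) ⟩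
          D I′ * (S + (pochhammer (- I′) (suc k) * s (suc k) * (d k * f)
                     + c (suc k) * pochhammer (I + 1ℚ - (u + u)) (suc k) * (d k * f)))
            - (fromℕ 2 * (u * u) + θ * (c (suc k) * s (suc k)) * (d k * f))
            ≡⟨ cong₂ (λ x y → D I′ * (S + (x * s (suc k) * (d k * f) + c (suc k) * y * (d k * f)))
                       - (fromℕ 2 * (u * u) + θ * (c (suc k) * s (suc k)) * (d k * f)))
                 (trans (pochhammer-suc (- I′) k) (cong (λ z → - I′ * pochhammer z k) shift₁))
                 (trans (pochhammer-suc (I + 1ℚ - (u + u)) k) (cong (λ z → (I + 1ℚ - (u + u)) * pochhammer z k) shift₂)) ⟩
          D I′ * (S + (- I′ * c k * (s k * (I′ + 1ℚ - (u + u) + K)) * (d k * f)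
                     + c k * (- I + K) * ((I + 1ℚ - (u + u)) * s k) * (d k * f)))
            - (fromℕ 2 * (u * u) + θ * (c k * (- I + K) * (s k * (I′ + 1ℚ - (u + u) + K))) * (d k * f))
            ≡⟨ step I I′ K (fromℕ (suc k)) S (c k) (s k) (d k) f (fromℕ-suc i) (fromℕ-suc k) (*-⁻¹ (D≢0 k)) ⟩
          remainder k + fromℕ 2 * (u * (u * u)) * ((I - fromℕ k) * (c k * s k) * (d k * f)) ∎
          where
          K S f : ℚ
          K = fromℕ k
          S = ∑[k≤ k ] (λ k → R-term I′ k + R-term I k)
          f = D (fromℕ (suc k)) ⁻¹
          shift₁ : - I′ + 1ℚ ≡ - I
          shift₁ = trans (cong (λ z → - z + 1ℚ) (fromℕ-suc i)) (cancel I)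
            where
            cancel : ∀ x → - (x + 1ℚ) + 1ℚ ≡ - x
            cancel = solve-∀ ℚ-ring
          shift₂ : I + 1ℚ - (u + u) + 1ℚ ≡ I′ + 1ℚ - (u + u)
          shift₂ = trans (commute I u) (cong (λ z → z + 1ℚ - (u + u)) (sym (fromℕ-suc i)))
            where
            commute : ∀ x u → x + 1ℚ - (u + u) + 1ℚ ≡ x + 1ℚ + 1ℚ - (u + u)
            commute = solve-∀ ℚ-ring
          identity : ∀ u I K S c s d f →
            ((I + 1ℚ) * (I + 1ℚ) + (- u) * (I + 1ℚ) + u * u) * (S + (- (I + 1ℚ) * c * (s * ((I + 1ℚ) + 1ℚ - (u + u) + K)) * (d * f)
                     + c * (- I + K) * ((I + 1ℚ - (u + u)) * s) * (d * f)))
            - (fromℕ 2 * (u * u) + fromℕ 2 * (I + 1ℚ) * ((I + 1ℚ) - u) * (c * (- I + K) * (s * ((I + 1ℚ) + 1ℚ - (u + u) + K))) * (d * f))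
            ≡ ((I + 1ℚ) * (I + 1ℚ) + (- u) * (I + 1ℚ) + u * u) * S - (fromℕ 2 * (u * u) + fromℕ 2 * (I + 1ℚ) * ((I + 1ℚ) - u) * (c * s) * d)
              + fromℕ 2 * (u * (u * u)) * ((I - K) * (c * s) * (d * f))
              + (- (fromℕ 2 * (I + 1ℚ) * ((I + 1ℚ) - u) * (c * s) * d)) * (((K + 1ℚ) * (K + 1ℚ) + (- u) * (K + 1ℚ) + u * u) * f - 1ℚ)
          identity = solve-∀ ℚ-ring
          step : ∀ I I′ K K′ S c s d f → I′ ≡ I + 1ℚ → K′ ≡ K + 1ℚ → D K′ * f ≡ 1ℚ →
            D I′ * (S + (- I′ * c * (s * (I′ + 1ℚ - (u + u) + K)) * (d * f)
                     + c * (- I + K) * ((I + 1ℚ - (u + u)) * s) * (d * f)))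
            - (fromℕ 2 * (u * u) + fromℕ 2 * I′ * (I′ - u) * (c * (- I + K) * (s * (I′ + 1ℚ - (u + u) + K))) * (d * f))
            ≡ D I′ * S - (fromℕ 2 * (u * u) + fromℕ 2 * I′ * (I′ - u) * (c * s) * d)
              + fromℕ 2 * (u * (u * u)) * ((I - K) * (c * s) * (d * f))
          step I _ K _ S c s d f refl refl f-inverse =
            combine₁ (- (fromℕ 2 * (I + 1ℚ) * ((I + 1ℚ) - u) * (c * s) * d)) f-inverse (identity u I K S c s d f)

        remainder∈ : ∀ k → k ℕ.< p → remainder k ∈𝔭^ 3
        remainder∈ zero    _     = ∈-resp (sym remainder-zero) 0∈
        remainder∈ (suc k) 1+k<p = ∈-resp (sym (remainder-suc k)) (remainder∈ k k<p ∈+ ℕ∈ 2 ∈* (u∈ ∈* (u∈ ∈* u∈)) ∈*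
          ((ℕ∈ i ∈- ℕ∈ k) ∈* (∈-pochhammer (∈-neg (ℕ∈ i)) k ∈* ∈-pochhammer (ℕ∈ (suc i) ∈+ 1∈ ∈- (u∈0 ∈+ u∈0)) k)
            ∈* (d∈ k<p ∈* unit-⁻¹ (unit-D 1+k<p))))
          where
          k<p : k ℕ.< p
          k<p = ℕ.<-trans (ℕ.n<1+n k) 1+k<p
          u∈0 : u ∈𝔭^ 0
          u∈0 = ∈-weaken u∈

    -- At k = i + 1 the factor (-i)_{i+1} is zero. This removes the boundary term of `remainder` and
    -- lets the sum for `R i` run one index further.
    R-recurrence : ∀ i → suc i ℕ.< p → D (fromℕ (suc i)) * (R (suc i) + R i) - fromℕ 2 * (u * u) ∈𝔭^ 3
    R-recurrence i 1+i<p = ∈-resp (begin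
      D I′ * ∑[k≤ suc i ] (λ k → R-term I′ k + R-term I k) - (fromℕ 2 * (u * u) + θ * (c (suc i) * s (suc i)) * d (suc i))
        ≡⟨ cong₂ (λ S x → D I′ * S - (fromℕ 2 * (u * u) + θ * (x * s (suc i)) * d (suc i))) sums c-vanishes ⟩
      D I′ * (R (suc i) + R i) - (fromℕ 2 * (u * u) + θ * (0ℚ * s (suc i)) * d (suc i))
        ≡⟨ identity (D I′ * (R (suc i) + R i)) (fromℕ 2 * (u * u)) θ (s (suc i)) (d (suc i)) ⟩
      D I′ * (R (suc i) + R i) - fromℕ 2 * (u * u) ∎) (remainder∈ (suc i) 1+i<p)
      where
      open Step i
      c-vanishes : c (suc i) ≡ 0ℚ
      c-vanishes = pochhammer-neg (ℕ.n<1+n i)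
      sums : ∑[k≤ suc i ] (λ k → R-term I′ k + R-term I k) ≡ R (suc i) + R i
      sums = trans (∑-+ (suc i) (R-term I′) (R-term I)) (cong (_+_ (R (suc i))) (trans (∑-snoc i (R-term I))
        (trans (cong (_+_ (R i)) (x≡0⇒x*y≡0 (d (suc i)) (x≡0⇒x*y≡0 (pochhammer (I + 1ℚ - (u + u)) (suc i)) c-vanishes)))
          (+-identityʳ (R i)))))
      identity : ∀ x y θ s d → x - (y + θ * (0ℚ * s) * d) ≡ x - y
      identity = solve-∀ ℚ-ring

    R≡ : ∀ i → i ℕ.< p → R i - ((- 1ℚ) ^ i + u * u * E r m≡2r u∈ i) ∈𝔭^ 3
    R≡ zero    _     = ∈-resp (identity (u * u * e 0)) (∈-neg (u∈ ∈* u∈ ∈* E-zero r m≡2r u∈))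
      where
      e : ℕ → ℚ
      e = E r m≡2r u∈
      identity : ∀ x → - x ≡ 1ℚ * 1ℚ * 1ℚ + 0ℚ - (1ℚ + x)
      identity = solve-∀ ℚ-ring
    R≡ (suc i) 1+i<p = ∈-resp (identity (R (suc i)) (R i) (e (suc i)) (e i) ((- 1ℚ) ^ i) (u * u))
      (T∈ ∈- R≡ i (ℕ.<-trans (ℕ.n<1+n i) 1+i<p))
      where
      e : ℕ → ℚ
      e = E r m≡2r u∈
      I δ A B : ℚ
      I = fromℕ (suc i)
      δ = u * u
      A = R (suc i) + R i
      B = e (suc i) + e i
      identity : ∀ R′ R e′ e x δ → R′ + R - δ * (e′ + e) - (R - (x + δ * e)) ≡ R′ - ((- 1ℚ) * x + δ * e′)
      identity = solve-∀ ℚ-ring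
      -- This bound allows D(I) to be replaced by I² in the recurrence: D(I) - I² = u (u - I), and
      -- its product with A lies in p³.
      A∈ : A ∈𝔭^ 2
      A∈ = unit-cancel A (D≢0 i) (unit-D 1+i<p) (∈-resp (cancel (D I * A) (fromℕ 2 * δ))
        (∈-pred (R-recurrence i 1+i<p) ∈+ ℕ∈ 2 ∈* (u∈ ∈* u∈)))
        where
        cancel : ∀ x y → x - y + y ≡ x
        cancel = solve-∀ ℚ-ring
      T∈ : A - δ * B ∈𝔭^ 3
      T∈ = unit-cancel (A - δ * B) (*-≢0 (fromℕ-≢0 (suc i)) (fromℕ-≢0 (suc i))) (unit-* (unit-suc 1+i<p) (unit-suc 1+i<p))
        (∈-resp (combination I u A B) (R-recurrence i 1+i<p ∈- u∈ ∈* u∈ ∈* E-step r m≡2r u∈ i 1+i<p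
          ∈- u∈ ∈* (∈-weaken u∈ ∈- ℕ∈ (suc i)) ∈* A∈))
        where
        combination : ∀ I u A B → (I * I + (- u) * I + u * u) * A - fromℕ 2 * (u * u) - u * u * (B * (I * I) - fromℕ 2) - u * (u - I) * A
          ≡ I * I * (A - u * u * B)
        combination = solve-∀ ℚ-ring

-- The deformed sums for p = 4n + 1

module Truncation (m : ℕ) (p-prime : Prime (3 ℕ.+ m)) (n′ : ℕ) (p≡1+4n : 3 ℕ.+ m ≡ 1 ℕ.+ 4 ℕ.* suc n′) where

  open Residues m p-prime

  n : ℕ
  n = suc n′

  a N u κ : ℚ
  a = + 1 / 4
  N = fromℕ n
  u = a + N
  κ = u * u * u

  r : ℕ
  r = 2 ℕ.* n′

  m≡2r : m ≡ 2 ℕ.* suc r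
  m≡2r = ℕ.+-cancelˡ-≡ 3 m (2 ℕ.* suc r) (trans p≡1+4n (identity n′))
    where
    identity : ∀ k → 1 ℕ.+ 4 ℕ.* suc k ≡ 3 ℕ.+ 2 ℕ.* suc (2 ℕ.* k)
    identity = ℕ-Solver.solve-∀

  n<p : n ℕ.< p
  n<p = subst (n ℕ.<_) (sym p≡1+4n) (s≤s (ℕ.m≤n*m n 4))

  P≡ : P ≡ 1ℚ + fromℕ 4 * N
  P≡ = trans (cong fromℕ p≡1+4n) (trans (fromℕ-+ 1 (4 ℕ.* n)) (cong (_+_ 1ℚ) (fromℕ-* 4 n)))

  u≡ : u ≡ P * a
  u≡ = trans (identity N) (cong (_* a) (sym P≡))
    where
    identity : ∀ N → (+ 1 / 4) + N ≡ (1ℚ + fromℕ 4 * N) * (+ 1 / 4)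
    identity = solve-∀ ℚ-ring

  a∈ : a ∈𝔭^ 0
  a∈ = unit-⁻¹ (unit-suc {3} (subst (4 ℕ.<_) (sym p≡1+4n) (s≤s (ℕ.m≤m*n 4 n))))

  u∈ : u ∈𝔭^ 1
  u∈ = ∈-resp (sym u≡) (P∈ ∈* a∈)

  κ∈ : κ ∈𝔭^ 3
  κ∈ = u∈ ∈* u∈ ∈* u∈

  v : ℚ → ℕ → ℚ
  v c i = fromℕ i * fromℕ i * fromℕ i + c

  unit-v : ∀ {c j} → c ∈𝔭^ 1 → suc j ℕ.< p → Unit (v c (suc j))
  unit-v {c} {j} c∈ 1+j<p = unit-≡ (unit-* (unit-* u-j u-j) u-j) (∈-resp (identity (fromℕ (suc j)) c) c∈)
    where
    u-j : Unit (fromℕ (suc j))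
    u-j = unit-suc 1+j<p
    identity : ∀ J c → c ≡ J * J * J + c - J * J * J
    identity = solve-∀ ℚ-ring

  v-0≢0 : ∀ j → v 0ℚ (suc j) ≢ 0ℚ
  v-0≢0 j e = *-≢0 (*-≢0 (fromℕ-≢0 (suc j)) (fromℕ-≢0 (suc j))) (fromℕ-≢0 (suc j)) (trans (sym (+-identityʳ (fromℕ (suc j) * fromℕ (suc j) * fromℕ (suc j)))) e)

  -- Multiplication by 64 = 4³ turns J³ + u³ into the positive integer p³ + (4J)³.
  v-κ≢0 : ∀ j → v κ (suc j) ≢ 0ℚ
  v-κ≢0 j = *≢0⇒≢0 (fromℕ 64) (fromℕ-≢0 (p ℕ.* p ℕ.* p ℕ.+ i ℕ.* i ℕ.* i)) (begin
    fromℕ 64 * (J * J * J + u * u * u)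
      ≡⟨ identity J N ⟩
    (1ℚ + fromℕ 4 * N) * (1ℚ + fromℕ 4 * N) * (1ℚ + fromℕ 4 * N) + fromℕ 4 * J * (fromℕ 4 * J) * (fromℕ 4 * J)
      ≡⟨ cong₂ _+_ (trans (cong (λ x → x * x * x) (sym P≡)) (sym (cube p)))
           (trans (cong (λ x → x * x * x) (sym (fromℕ-* 4 (suc j)))) (sym (cube i))) ⟩
    fromℕ (p ℕ.* p ℕ.* p) + fromℕ (i ℕ.* i ℕ.* i)
      ≡⟨ sym (fromℕ-+ (p ℕ.* p ℕ.* p) (i ℕ.* i ℕ.* i)) ⟩
    fromℕ (p ℕ.* p ℕ.* p ℕ.+ i ℕ.* i ℕ.* i) ∎)
    where
    i : ℕ
    i = 4 ℕ.* suc j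
    J : ℚ
    J = fromℕ (suc j)
    cube : ∀ k → fromℕ (k ℕ.* k ℕ.* k) ≡ fromℕ k * fromℕ k * fromℕ k
    cube k = trans (fromℕ-* (k ℕ.* k) k) (cong (_* fromℕ k) (fromℕ-* k k))
    identity : ∀ J N → fromℕ 64 * (J * J * J + (+ 1 / 4 + N) * (+ 1 / 4 + N) * (+ 1 / 4 + N)) ≡
      (1ℚ + fromℕ 4 * N) * (1ℚ + fromℕ 4 * N) * (1ℚ + fromℕ 4 * N) + fromℕ 4 * J * (fromℕ 4 * J) * (fromℕ 4 * J)
    identity = solve-∀ ℚ-ring

  denominator≢0 : ∀ i k → 1ℚ + a + fromℕ i + fromℕ k ≢ 0ℚ
  denominator≢0 i k = *≢0⇒≢0 (fromℕ 4) (fromℕ-≢0 (5 ℕ.+ 4 ℕ.* (i ℕ.+ k))) (begin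
    fromℕ 4 * (1ℚ + a + fromℕ i + fromℕ k)   ≡⟨ identity (fromℕ i) (fromℕ k) ⟩
    fromℕ 5 + fromℕ 4 * (fromℕ i + fromℕ k)  ≡⟨ cong (λ x → fromℕ 5 + fromℕ 4 * x) (sym (fromℕ-+ i k)) ⟩
    fromℕ 5 + fromℕ 4 * fromℕ (i ℕ.+ k)      ≡⟨ cong (_+_ (fromℕ 5)) (sym (fromℕ-* 4 (i ℕ.+ k))) ⟩
    fromℕ 5 + fromℕ (4 ℕ.* (i ℕ.+ k))        ≡⟨ sym (fromℕ-+ 5 (4 ℕ.* (i ℕ.+ k))) ⟩
    fromℕ (5 ℕ.+ 4 ℕ.* (i ℕ.+ k))            ∎)
    where
    identity : ∀ x y → fromℕ 4 * (1ℚ + (+ 1 / 4) + x + y) ≡ fromℕ 5 + fromℕ 4 * (x + y)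
    identity = solve-∀ ℚ-ring

  -- A 0 k is (-1)ᵏ (1/4)ₖ³ / k!³, and B c k is A c k with a + j replaced by j - n,
  -- to which it is congruent mod p. B c k is symmetric under k ↦ n - k.

  ρ σ : ℚ → ℕ → ℚ
  ρ c j = (c - (a + fromℕ j) * (a + fromℕ j) * (a + fromℕ j)) * v c (suc j) ⁻¹
  σ c j = v c (n ∸ j) * v c (suc j) ⁻¹

  A B : ℚ → ℕ → ℚ
  A c k = ∏[j< k ] (ρ c)
  B c k = ∏[j< k ] (σ c)

  G : ℚ → ℕ → ℚ
  G c k = ∑[k≤ k ] (λ k → (fromℕ 8 * fromℕ k + 1ℚ) * A c k)

  -- Invariance under the deformation modulo p⁴

  module Perturbation where

    v∈ : ∀ {c} → c ∈𝔭^ 0 → ∀ i → v c i ∈𝔭^ 0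
    v∈ c∈ i = ℕ∈ i ∈* ℕ∈ i ∈* ℕ∈ i ∈+ c∈

    ρ∈ : ∀ {c} → c ∈𝔭^ 1 → ∀ {j} → suc j ℕ.< p → ρ c j ∈𝔭^ 0
    ρ∈ c∈ {j} 1+j<p = (∈-weaken c∈ ∈- (a∈ ∈+ ℕ∈ j) ∈* (a∈ ∈+ ℕ∈ j) ∈* (a∈ ∈+ ℕ∈ j)) ∈* unit-⁻¹ (unit-v c∈ 1+j<p)

    σ∈ : ∀ {c} → c ∈𝔭^ 1 → ∀ {j} → suc j ℕ.< p → σ c j ∈𝔭^ 0
    σ∈ c∈ {j} 1+j<p = v∈ (∈-weaken c∈) (n ∸ j) ∈* unit-⁻¹ (unit-v c∈ 1+j<p)

    κ∈₁ : κ ∈𝔭^ 1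
    κ∈₁ = ∈-pred (∈-pred κ∈)

    A∈ : ∀ {c} → c ∈𝔭^ 1 → ∀ {k} → k ℕ.< p → A c k ∈𝔭^ 0
    A∈ c∈ {k} k<p = ∈-∏ k λ j j<k → ρ∈ c∈ (ℕ.≤-<-trans j<k k<p)

    B∈ : ∀ {c} → c ∈𝔭^ 1 → ∀ {k} → k ℕ.< p → B c k ∈𝔭^ 0
    B∈ c∈ {k} k<p = ∈-∏ k λ j j<k → σ∈ c∈ (ℕ.≤-<-trans j<k k<p)

    module Factor {j : ℕ} (j<n : j ℕ.< n) where

      1+j<p : suc j ℕ.< p
      1+j<p = ℕ.≤-<-trans j<n n<p

      x y z i i₀ : ℚ
      x = a + fromℕ j
      y = fromℕ (n ∸ j)
      z = x * x * x + y * y * y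
      i = v κ (suc j) ⁻¹
      i₀ = v 0ℚ (suc j) ⁻¹

      i∈ : i ∈𝔭^ 0
      i∈ = unit-⁻¹ (unit-v κ∈₁ 1+j<p)

      i₀∈ : i₀ ∈𝔭^ 0
      i₀∈ = unit-⁻¹ (unit-v 0∈ 1+j<p)

      -- x + y = a + n = u divides x³ + y³. For either value of c, ρ - σ is -z times the inverse
      -- denominator, since c cancels in the numerator.
      z∈ : z ∈𝔭^ 1
      z∈ = ∈-resp (factor x y) (x+y∈ ∈* (x∈ ∈* x∈ ∈- x∈ ∈* ℕ∈ (n ∸ j) ∈+ ℕ∈ (n ∸ j) ∈* ℕ∈ (n ∸ j)))
        where
        factor : ∀ x y → (x + y) * (x * x - x * y + y * y) ≡ x * x * x + y * y * y
        factor = solve-∀ ℚ-ring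
        cancel : ∀ a J N → a + N ≡ a + J + (N - J)
        cancel = solve-∀ ℚ-ring
        x∈ : x ∈𝔭^ 0
        x∈ = a∈ ∈+ ℕ∈ j
        x+y∈ : x + y ∈𝔭^ 1
        x+y∈ = ∈-resp (trans (cancel a (fromℕ j) N) (cong (_+_ x) (sym (fromℕ-∸ (ℕ.<⇒≤ j<n))))) u∈

      i-i₀ : i - i₀ ≡ - (κ * (i * i₀))
      i-i₀ = combine₂ i₀ (*-⁻¹ (v-κ≢0 j)) (- i) (*-⁻¹ (v-0≢0 j)) (identity (fromℕ (suc j)) κ i i₀)
        where
        identity : ∀ J κ i i₀ → i - i₀ ≡ - (κ * (i * i₀)) + i₀ * ((J * J * J + κ) * i - 1ℚ) + (- i) * ((J * J * J + 0ℚ) * i₀ - 1ℚ)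
        identity = solve-∀ ℚ-ring

      ρ₀-σ₀∈ : ρ 0ℚ j - σ 0ℚ j ∈𝔭^ 1
      ρ₀-σ₀∈ = ∈-resp (identity x y i₀) (∈-neg z∈ ∈* i₀∈)
        where
        identity : ∀ x y i → - (x * x * x + y * y * y) * i ≡ (0ℚ - x * x * x) * i - (y * y * y + 0ℚ) * i
        identity = solve-∀ ℚ-ring

      ρ-σ∈ : ρ κ j - σ κ j ∈𝔭^ 1
      ρ-σ∈ = ∈-resp (identity x y κ i) (∈-neg z∈ ∈* i∈)
        where
        identity : ∀ x y κ i → - (x * x * x + y * y * y) * i ≡ (κ - x * x * x) * i - (y * y * y + κ) * i
        identity = solve-∀ ℚ-ring

      σ-σ₀∈ : σ κ j - σ 0ℚ j ∈𝔭^ 3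
      σ-σ₀∈ = ∈-resp (sym (combine₁ (y * y * y) i-i₀ (identity y κ i i₀)))
        (κ∈ ∈* (i∈ ∈- ℕ∈ (n ∸ j) ∈* ℕ∈ (n ∸ j) ∈* ℕ∈ (n ∸ j) ∈* (i∈ ∈* i₀∈)))
        where
        identity : ∀ y κ i i₀ → (y * y * y + κ) * i - (y * y * y + 0ℚ) * i₀ ≡ κ * (i - y * y * y * (i * i₀)) + y * y * y * (i - i₀ - - (κ * (i * i₀)))
        identity = solve-∀ ℚ-ring

      -- The mixed difference is -z (i - i₀): one power of p comes from z, three from the change of
      -- the denominator.
      Δρ-Δσ∈ : (ρ κ j - ρ 0ℚ j) - (σ κ j - σ 0ℚ j) ∈𝔭^ 4
      Δρ-Δσ∈ = ∈-resp (sym (combine₁ (- z) i-i₀ (identity x y κ i i₀))) (z∈ ∈* (κ∈ ∈* (i∈ ∈* i₀∈)))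
        where
        identity : ∀ x y κ i i₀ → (κ - x * x * x) * i - (0ℚ - x * x * x) * i₀ - ((y * y * y + κ) * i - (y * y * y + 0ℚ) * i₀)
          ≡ (x * x * x + y * y * y) * (κ * (i * i₀)) + (- (x * x * x + y * y * y)) * (i - i₀ - - (κ * (i * i₀)))
        identity = solve-∀ ℚ-ring

    A₀-B₀∈ : ∀ {k} → k ℕ.≤ n → A 0ℚ k - B 0ℚ k ∈𝔭^ 1
    A₀-B₀∈ {k} k≤n = ∏-cong∈ k λ j j<k → let j<n = ℕ.≤-trans j<k k≤n; 1+j<p = ℕ.≤-<-trans j<n n<p in
      ρ∈ 0∈ 1+j<p , σ∈ 0∈ 1+j<p , Factor.ρ₀-σ₀∈ j<n

    B-B₀∈ : ∀ {k} → k ℕ.≤ n → B κ k - B 0ℚ k ∈𝔭^ 3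
    B-B₀∈ {zero}  _   = 0∈
    B-B₀∈ {suc k} k<n = ∈-resp (identity (B κ k) (B 0ℚ k) (σ κ k) (σ 0ℚ k))
      (B-B₀∈ (ℕ.<⇒≤ k<n) ∈* σ∈ κ∈₁ 1+j<p ∈+ B∈ 0∈ (ℕ.<-trans k<n n<p) ∈* σ-σ₀∈)
      where
      open Factor k<n
      identity : ∀ R S x y → (R - S) * x + S * (x - y) ≡ R * x - S * y
      identity = solve-∀ ℚ-ring

    -- The product rule for a mixed second difference: changing c costs p³, changing ρ to σ costs p,
    -- and each of the four terms collects both, with orders 4 + 0, 3 + 1, 0 + 4 and 1 + 3.
    ΔA-ΔB∈ : ∀ {k} → k ℕ.≤ n → (A κ k - A 0ℚ k) - (B κ k - B 0ℚ k) ∈𝔭^ 4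
    ΔA-ΔB∈ {zero}  _   = 0∈
    ΔA-ΔB∈ {suc k} k<n = ∈-resp (identity (A κ k) (A 0ℚ k) (B κ k) (B 0ℚ k) (ρ κ k) (ρ 0ℚ k) (σ κ k) (σ 0ℚ k))
      (ΔA-ΔB∈ k≤n ∈* ρ∈ κ∈₁ 1+j<p ∈+ B-B₀∈ k≤n ∈* ρ-σ∈ ∈+ A∈ 0∈ (ℕ.<-trans k<n n<p) ∈* Δρ-Δσ∈ ∈+ A₀-B₀∈ k≤n ∈* σ-σ₀∈)
      where
      open Factor k<n
      k≤n : k ℕ.≤ n
      k≤n = ℕ.<⇒≤ k<n
      identity : ∀ A A₀ B B₀ r r₀ s s₀ →
        ((A - A₀) - (B - B₀)) * r + (B - B₀) * (r - s) + A₀ * ((r - r₀) - (s - s₀)) + (A₀ - B₀) * (s - s₀)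
        ≡ (A * r - A₀ * r₀) - (B * s - B₀ * s₀)
      identity = solve-∀ ℚ-ring

    -- Modulo p⁴ the change of A may be replaced by that of B, which is exactly symmetric and lies
    -- in p³; opposite weights add up to 8n + 2 = 2p.
    G-G₀∈ : G κ n - G 0ℚ n ∈𝔭^ 4
    G-G₀∈ = ∈-resp (begin
      ∑[k≤ n ] (λ k → w k * ((A κ k - A 0ℚ k) - (B κ k - B 0ℚ k))) + ∑[k≤ n ] (λ k → w k * (B κ k - B 0ℚ k))
        ≡⟨ sym (∑-+ n (λ k → w k * ((A κ k - A 0ℚ k) - (B κ k - B 0ℚ k))) (λ k → w k * (B κ k - B 0ℚ k))) ⟩
      ∑[k≤ n ] (λ k → w k * ((A κ k - A 0ℚ k) - (B κ k - B 0ℚ k)) + w k * (B κ k - B 0ℚ k))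
        ≡⟨ ∑-cong n (λ k _ → regroup (w k) (A κ k) (A 0ℚ k) (B κ k - B 0ℚ k)) ⟩
      ∑[k≤ n ] (λ k → w k * A κ k - w k * A 0ℚ k)
        ≡⟨ ∑-- n (λ k → w k * A κ k) (λ k → w k * A 0ℚ k) ⟩
      G κ n - G 0ℚ n ∎)
      (∈-∑ n (λ k k≤n → ((ℕ∈ 8 ∈* ℕ∈ k) ∈+ 1∈) ∈* ΔA-ΔB∈ k≤n) ∈+ ∑-antisymmetric n (λ k → w k * (B κ k - B 0ℚ k)) λ k k≤n →
        ∈-resp (trans (cong (_* (B κ k - B 0ℚ k)) (weights k k≤n)) (trans (*-distribʳ-+ (B κ k - B 0ℚ k) (w k) (w (n ∸ k)))
            (cong (λ x → w k * (B κ k - B 0ℚ k) + w (n ∸ k) * x)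
              (sym (cong₂ _-_ (∏-symmetric n (v κ) v-κ≢0 k≤n) (∏-symmetric n (v 0ℚ) v-0≢0 k≤n))))))
          (ℕ∈ 2 ∈* P∈ ∈* B-B₀∈ k≤n))
      where
      w : ℕ → ℚ
      w k = fromℕ 8 * fromℕ k + 1ℚ
      regroup : ∀ w A A₀ Δ → w * ((A - A₀) - Δ) + w * Δ ≡ w * A - w * A₀
      regroup = solve-∀ ℚ-ring
      identity : ∀ N K → fromℕ 2 * (1ℚ + fromℕ 4 * N) ≡ fromℕ 8 * K + 1ℚ + (fromℕ 8 * (N - K) + 1ℚ)
      identity = solve-∀ ℚ-ring
      weights : ∀ k → k ℕ.≤ n → fromℕ 2 * P ≡ w k + w (n ∸ k)
      weights k k≤n = trans (cong (_*_ (fromℕ 2)) P≡) (trans (identity N (fromℕ k))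
        (cong (λ x → w k + (fromℕ 8 * x + 1ℚ)) (sym (fromℕ-∸ k≤n))))

  -- Exact evaluation at c = u³ by Whipple's transformation

  module Evaluation where

    open Saalschütz a (- u) (u * u) using (g) renaming (N to numerator)
    open Recurrence m p-prime r m≡2r u u∈ using (D; d; R; R≡)
    open WellPoised a denominator≢0 using (w; whipple)

    J+u≢0 : ∀ j → 1ℚ + a + N + fromℕ j ≢ 0ℚ
    J+u≢0 = denominator≢0 n

    v-factors : ∀ j → (1ℚ + a + N + fromℕ j) * D (fromℕ (suc j)) ≡ v κ (suc j)
    v-factors j = trans (cong (_* D (fromℕ (suc j))) (trans (commute a N (fromℕ j)) (cong (_+ u) (sym (fromℕ-suc j)))))
      (identity (fromℕ (suc j)) u)
      where
      commute : ∀ a N x → 1ℚ + a + N + x ≡ x + 1ℚ + (a + N)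
      commute = solve-∀ ℚ-ring
      identity : ∀ J u → (J + u) * (J * J + (- u) * J + u * u) ≡ J * J * J + u * u * u
      identity = solve-∀ ℚ-ring

    D≢0 : ∀ j → D (fromℕ (suc j)) ≢ 0ℚ
    D≢0 j = *≢0⇒≢0 (1ℚ + a + N + fromℕ j) (v-κ≢0 j) (v-factors j)

    -- A difference or sum of cubes splits over ℚ into a linear and a quadratic factor; the linear
    -- factors assemble to `w`, the quadratic ones to `g`.
    A-factors : ∀ k → A κ k ≡ w N k * g k
    A-factors k = trans (∏-cong k λ j _ → trans (cong₂ _*_ (identity a N (fromℕ j)) (inverse j))
        (regroup (N - fromℕ j) (numerator (a + fromℕ j)) ((1ℚ + a + N + fromℕ j) ⁻¹) (D (fromℕ (suc j)) ⁻¹)))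
      (∏-* k (λ j → (N - fromℕ j) * (1ℚ + a + N + fromℕ j) ⁻¹) (λ j → numerator (a + fromℕ j) * D (fromℕ (suc j)) ⁻¹))
      where
      inverse : ∀ j → v κ (suc j) ⁻¹ ≡ (1ℚ + a + N + fromℕ j) ⁻¹ * D (fromℕ (suc j)) ⁻¹
      inverse j = trans (cong _⁻¹ (sym (v-factors j))) (⁻¹-distrib-* (J+u≢0 j) (D≢0 j))
      identity : ∀ a N x → (a + N) * (a + N) * (a + N) - (a + x) * (a + x) * (a + x)
        ≡ (N - x) * ((a + x) * (a + x) - (- (a + N)) * (a + x) + (a + N) * (a + N))
      identity = solve-∀ ℚ-ring
      regroup : ∀ x y i j → x * y * (i * j) ≡ x * i * (y * j)
      regroup = solve-∀ ℚ-ring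

    G-κ : G κ n ≡ P * R n
    G-κ = begin
      ∑[k≤ n ] (λ k → (fromℕ 8 * fromℕ k + 1ℚ) * A κ k)
        ≡⟨ ∑-cong n (λ k _ → trans (cong (_*_ (fromℕ 8 * fromℕ k + 1ℚ)) (A-factors k)) (quadruple (fromℕ k) (w N k * g k))) ⟩
      ∑[k≤ n ] (λ k → fromℕ 4 * ((a + fromℕ k + fromℕ k) * (w N k * g k)))
        ≡⟨ ∑-* n (fromℕ 4) (λ k → (a + fromℕ k + fromℕ k) * (w N k * g k)) ⟩
      fromℕ 4 * ∑[k≤ n ] (λ k → (a + fromℕ k + fromℕ k) * (w N k * g k))
        ≡⟨ cong (_*_ (fromℕ 4)) (whipple (- u) (u * u) D≢0 n) ⟩
      fromℕ 4 * (u * ∑[k≤ n ] (λ i → pochhammer (- N) i * pochhammer (1ℚ - a + - u) i * d i))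
        -- Since a = u - n, the parameter 1 - a - u is the n + 1 - 2u that occurs in `R n`.
        ≡⟨ cong (λ x → fromℕ 4 * (u * ∑[k≤ n ] (λ i → pochhammer (- N) i * pochhammer x i * d i))) (parameter a N) ⟩
      fromℕ 4 * (u * R n)
        ≡⟨ trans (sym (*-assoc (fromℕ 4) u (R n))) (cong (_* R n) (trans (expand N) (sym P≡))) ⟩
      P * R n ∎
      where
      quadruple : ∀ k X → (fromℕ 8 * k + 1ℚ) * X ≡ fromℕ 4 * ((+ 1 / 4 + k + k) * X)
      quadruple = solve-∀ ℚ-ring
      parameter : ∀ a N → 1ℚ - a + - (a + N) ≡ N + 1ℚ - (a + N + (a + N))
      parameter = solve-∀ ℚ-ring
      expand : ∀ N → fromℕ 4 * (+ 1 / 4 + N) ≡ 1ℚ + fromℕ 4 * N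
      expand = solve-∀ ℚ-ring

    G-κ≡ : G κ n - (P * (- 1ℚ) ^ n + P * (u * u) * eulerPolynomial m a) ∈𝔭^ 4
    G-κ≡ = ∈-resp (sym (trans (cong₂ (λ x y → x - (P * (- 1ℚ) ^ n + P * (u * u) * y)) G-κ E-n)
        (identity P (R n) ((- 1ℚ) ^ n) (u * u) (E r m≡2r u∈ n)))) (P∈ ∈* R≡ D≢0 n n<p)
      where
      cancel : ∀ a N → a ≡ a + N - N
      cancel = solve-∀ ℚ-ring
      E-n : eulerPolynomial m a ≡ E r m≡2r u∈ n
      E-n = trans (eulerPolynomial≡ m a) (cong (λ x → fromℕ (m !) * euler x m) (cancel a N))
      identity : ∀ P R x δ e → P * R - (P * x + P * δ * e) ≡ P * (R - (x + δ * e))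
      identity = solve-∀ ℚ-ring

  -- The terms with n < k < p

  module Tail where

    open Perturbation

    -- Equal to p - 2 - n: writing k = n + 1 + i, the tail runs over i from 0 to `μ`.
    μ : ℕ
    μ = suc m ∸ n

    1+n+μ≡p-1 : suc n ℕ.+ μ ≡ 2 ℕ.+ m
    1+n+μ≡p-1 = cong suc (ℕ.m+[n∸m]≡n (ℕ.≤-pred (subst (suc n ℕ.≤_) (sym (ℕ.suc-injective p≡1+4n)) 1+n≤4n)))
      where
      1+n≤4n : suc n ℕ.≤ 4 ℕ.* n
      1+n≤4n = ℕ.+-mono-≤ (s≤s z≤n) (ℕ.m≤m+n n (n ℕ.+ (n ℕ.+ 0)))

    -- Modulo p, n + 2 + j = p - (μ - j) turns τ j into the symmetric ratio σ′ j.

    v⁻¹ τ σ′ : ℕ → ℚ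
    v⁻¹ i = v 0ℚ i ⁻¹
    τ j = ρ 0ℚ (suc n ℕ.+ j)
    σ′ j = v⁻¹ (μ ∸ j) * v⁻¹ (suc j) ⁻¹

    P≡1+N+μ+1 : P ≡ N + 1ℚ + fromℕ μ + 1ℚ
    P≡1+N+μ+1 = begin
      fromℕ (3 ℕ.+ m)                    ≡⟨ fromℕ-suc (2 ℕ.+ m) ⟩
      fromℕ (2 ℕ.+ m) + 1ℚ               ≡⟨ cong (λ k → fromℕ k + 1ℚ) (sym 1+n+μ≡p-1) ⟩
      fromℕ (suc n ℕ.+ μ) + 1ℚ           ≡⟨ cong (_+ 1ℚ) (fromℕ-+ (suc n) μ) ⟩
      fromℕ (suc n) + fromℕ μ + 1ℚ       ≡⟨ cong (λ x → x + fromℕ μ + 1ℚ) (fromℕ-suc n) ⟩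
      N + 1ℚ + fromℕ μ + 1ℚ              ∎

    1+n+j : ∀ j → fromℕ (suc n ℕ.+ j) ≡ N + 1ℚ + fromℕ j
    1+n+j j = trans (fromℕ-+ (suc n) j) (cong (_+ fromℕ j) (fromℕ-suc n))

    module Factor′ {j : ℕ} (j<μ : j ℕ.< μ) where

      2+n+j<p : suc (suc n ℕ.+ j) ℕ.< p
      2+n+j<p = s≤s (subst (suc n ℕ.+ j ℕ.<_) 1+n+μ≡p-1 (ℕ.+-monoʳ-< (suc n) j<μ))

      j<p : suc j ℕ.< p
      j<p = ℕ.≤-<-trans (s≤s (ℕ.m≤n+m j (suc n))) 2+n+j<p

      μ-j≡suc : μ ∸ j ≡ suc (μ ∸ suc j)
      μ-j≡suc = ℕ.+-∸-assoc 1 j<μ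

      μ-j<p : suc (μ ∸ suc j) ℕ.< p
      μ-j<p = subst (ℕ._< p) μ-j≡suc (ℕ.≤-<-trans (ℕ.m∸n≤m μ j)
        (ℕ.≤-<-trans (ℕ.m≤n+m μ (suc n)) (subst (ℕ._< p) (sym 1+n+μ≡p-1) (ℕ.n<1+n (2 ℕ.+ m)))))

      x J q L i₁ i₂ : ℚ
      x = a + fromℕ (suc n ℕ.+ j)
      J = fromℕ (suc j)
      q = fromℕ (μ ∸ j)
      L = fromℕ (suc (suc n ℕ.+ j))
      i₁ = v⁻¹ (μ ∸ j)
      i₂ = v⁻¹ (suc (suc n ℕ.+ j))

      i₁∈ : i₁ ∈𝔭^ 0
      i₁∈ = subst (λ k → v⁻¹ k ∈𝔭^ 0) (sym μ-j≡suc) (unit-⁻¹ (unit-v 0∈ μ-j<p))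

      i₂∈ : i₂ ∈𝔭^ 0
      i₂∈ = unit-⁻¹ (unit-v 0∈ 2+n+j<p)

      v-q≢0 : v 0ℚ (μ ∸ j) ≢ 0ℚ
      v-q≢0 = subst (λ k → v 0ℚ k ≢ 0ℚ) (sym μ-j≡suc) (v-0≢0 (μ ∸ suc j))

      x-J∈ : x - J ∈𝔭^ 1
      x-J∈ = ∈-resp (trans (identity a N (fromℕ j)) (cong₂ (λ y z → a + y - z) (sym (1+n+j j)) (sym (fromℕ-suc j)))) u∈
        where
        identity : ∀ a N j → a + N ≡ a + (N + 1ℚ + j) - (j + 1ℚ)
        identity = solve-∀ ℚ-ring

      q+L∈ : q + L ∈𝔭^ 1
      q+L∈ = ∈-resp (trans P≡1+N+μ+1 (trans (identity N (fromℕ μ) (fromℕ j))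
        (cong₂ _+_ (sym (fromℕ-∸ (ℕ.<⇒≤ j<μ))) (sym (trans (fromℕ-suc (suc n ℕ.+ j)) (cong (_+ 1ℚ) (1+n+j j))))))) P∈
        where
        identity : ∀ N μ j → N + 1ℚ + μ + 1ℚ ≡ μ - j + (N + 1ℚ + j + 1ℚ)
        identity = solve-∀ ℚ-ring

      v⁻¹-⁻¹ : ∀ j → v⁻¹ (suc j) ⁻¹ ≡ v 0ℚ (suc j)
      v⁻¹-⁻¹ j = ⁻¹-involutive (v-0≢0 j)

      x∈ : x ∈𝔭^ 0
      x∈ = a∈ ∈+ ℕ∈ (suc n ℕ.+ j)

      -- Here x = J + u and q + L = p, so -x³/L³ is J³/q³ mod p. The factors x - J and q + L come
      -- from x³ - J³ and q³ + L³.
      τ-σ′∈ : τ j - σ′ j ∈𝔭^ 1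
      τ-σ′∈ = ∈-resp (sym (trans (cong (λ y → τ j - i₁ * y) (v⁻¹-⁻¹ j))
          (combine₂ (J * J * J * i₂) (*-⁻¹ v-q≢0) (J * J * J * i₁) (*-⁻¹ (v-0≢0 (suc n ℕ.+ j))) (identity x J q L i₁ i₂))))
        (∈-neg (x-J∈ ∈* ((x∈ ∈* x∈ ∈+ x∈ ∈* J∈ ∈+ J∈ ∈* J∈) ∈* i₂∈)) ∈-
          q+L∈ ∈* ((q∈ ∈* q∈ ∈- q∈ ∈* L∈ ∈+ L∈ ∈* L∈) ∈* (J∈ ∈* J∈ ∈* J∈ ∈* (i₁∈ ∈* i₂∈))))
        where
        J∈ : J ∈𝔭^ 0
        J∈ = ℕ∈ (suc j)
        q∈ : q ∈𝔭^ 0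
        q∈ = ℕ∈ (μ ∸ j)
        L∈ : L ∈𝔭^ 0
        L∈ = ℕ∈ (suc (suc n ℕ.+ j))
        identity : ∀ x J q L i₁ i₂ → (0ℚ - x * x * x) * i₂ - i₁ * (J * J * J + 0ℚ) ≡
          - ((x - J) * ((x * x + x * J + J * J) * i₂)) - (q + L) * ((q * q - q * L + L * L) * (J * J * J * (i₁ * i₂)))
          + (J * J * J * i₂) * ((q * q * q + 0ℚ) * i₁ - 1ℚ) + (J * J * J * i₁) * ((L * L * L + 0ℚ) * i₂ - 1ℚ)
        identity = solve-∀ ℚ-ring

      τ∈ : τ j ∈𝔭^ 0
      τ∈ = ρ∈ 0∈ 2+n+j<p

      σ′∈ : σ′ j ∈𝔭^ 0
      σ′∈ = i₁∈ ∈* ∈-resp (sym (v⁻¹-⁻¹ j)) (integral (unit-v 0∈ j<p))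

    -- The factor with j = n has numerator -(a + n)³ = -u³.
    A-1+n∈ : A 0ℚ (suc n) ∈𝔭^ 3
    A-1+n∈ = A∈ 0∈ n<p ∈* ((0∈ ∈- κ∈) ∈* unit-⁻¹ (unit-v 0∈ 1+n<p))
      where
      1+n<p : suc n ℕ.< p
      1+n<p = s≤s (subst (suc n ℕ.≤_) 1+n+μ≡p-1 (ℕ.m≤m+n (suc n) μ))

    weight : ℕ → ℚ
    weight i = fromℕ 8 * fromℕ (suc n ℕ.+ i) + 1ℚ

    symmetric-sum∈ : ∑[k≤ μ ] (λ i → weight i * ∏[j< i ] σ′) ∈𝔭^ 1
    symmetric-sum∈ = ∑-antisymmetric μ (λ i → weight i * ∏[j< i ] σ′) λ i i≤μ →
      ∈-resp (trans (cong (_* ∏[j< i ] σ′) (weights i i≤μ)) (trans (*-distribʳ-+ (∏[j< i ] σ′) (weight i) (weight (μ ∸ i)))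
          (cong (λ x → weight i * ∏[j< i ] σ′ + weight (μ ∸ i) * x) (sym (∏-symmetric μ v⁻¹ (λ j → ⁻¹-≢0 (v-0≢0 j)) i≤μ)))))
        (ℕ∈ 10 ∈* P∈ ∈* ∈-∏ i λ j j<i → Factor′.σ′∈ (ℕ.≤-trans j<i i≤μ))
      where
      -- Opposite weights add up to 8 (n + μ + 2) + 2 (4n + 1) = 8p + 2p.
      weights : ∀ i → i ℕ.≤ μ → fromℕ 10 * P ≡ weight i + weight (μ ∸ i)
      weights i i≤μ = trans (combine₂ (fromℕ 2) P≡ (fromℕ 8) P≡1+N+μ+1 (identity P N (fromℕ μ) (fromℕ i)))
        (cong₂ (λ y z → fromℕ 8 * y + 1ℚ + (fromℕ 8 * z + 1ℚ)) (sym (1+n+j i))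
          (sym (trans (1+n+j (μ ∸ i)) (cong (_+_ (N + 1ℚ)) (fromℕ-∸ i≤μ)))))
        where
        identity : ∀ P N μ i → fromℕ 10 * P ≡ fromℕ 8 * (N + 1ℚ + i) + 1ℚ + (fromℕ 8 * (N + 1ℚ + (μ - i)) + 1ℚ)
          + fromℕ 2 * (P - (1ℚ + fromℕ 4 * N)) + fromℕ 8 * (P - (N + 1ℚ + μ + 1ℚ))
        identity = solve-∀ ℚ-ring

    -- Every tail term contains `A 0ℚ (suc n)`, which carries p³. The cofactor sum is therefore
    -- needed only mod p, where τ may be replaced by σ′.
    tail∈ : G 0ℚ (2 ℕ.+ m) - G 0ℚ n ∈𝔭^ 4
    tail∈ = ∈-resp (sym (begin
      G 0ℚ (2 ℕ.+ m) - G 0ℚ n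
        ≡⟨ cong (λ k → G 0ℚ k - G 0ℚ n) (sym 1+n+μ≡p-1) ⟩
      G 0ℚ (suc n ℕ.+ μ) - G 0ℚ n
        ≡⟨ cong (_- G 0ℚ n) (∑-split n μ (λ k → (fromℕ 8 * fromℕ k + 1ℚ) * A 0ℚ k)) ⟩
      G 0ℚ n + ∑[k≤ μ ] (λ i → weight i * A 0ℚ (suc n ℕ.+ i)) - G 0ℚ n
        ≡⟨ cancel (G 0ℚ n) (∑[k≤ μ ] (λ i → weight i * A 0ℚ (suc n ℕ.+ i))) ⟩
      ∑[k≤ μ ] (λ i → weight i * A 0ℚ (suc n ℕ.+ i))
        ≡⟨ ∑-cong μ (λ i _ → trans (cong (_*_ (weight i)) (∏-split (suc n) i (ρ 0ℚ))) (swap (weight i) (A 0ℚ (suc n)) (∏[j< i ] τ))) ⟩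
      ∑[k≤ μ ] (λ i → A 0ℚ (suc n) * (weight i * ∏[j< i ] τ))
        ≡⟨ ∑-* μ (A 0ℚ (suc n)) (λ i → weight i * ∏[j< i ] τ) ⟩
      A 0ℚ (suc n) * ∑[k≤ μ ] (λ i → weight i * ∏[j< i ] τ) ∎))
      (A-1+n∈ ∈* τ-sum∈)
      where
      cancel : ∀ x y → x + y - x ≡ y
      cancel = solve-∀ ℚ-ring
      swap : ∀ w A t → w * (A * t) ≡ A * (w * t)
      swap = solve-∀ ℚ-ring
      regroup : ∀ w s t → w * s + w * (t - s) ≡ w * t
      regroup = solve-∀ ℚ-ring
      τ-sum∈ : ∑[k≤ μ ] (λ i → weight i * ∏[j< i ] τ) ∈𝔭^ 1
      τ-sum∈ = ∈-resp (trans (sym (∑-+ μ (λ i → weight i * ∏[j< i ] σ′) (λ i → weight i * (∏[j< i ] τ - ∏[j< i ] σ′))))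
          (∑-cong μ (λ i _ → regroup (weight i) (∏[j< i ] σ′) (∏[j< i ] τ))))
        (symmetric-sum∈ ∈+ ∈-∑ μ λ i i≤μ → (ℕ∈ 8 ∈* ℕ∈ (suc n ℕ.+ i) ∈+ 1∈) ∈*
          ∏-cong∈ i λ j j<i → let open Factor′ (ℕ.≤-trans j<i i≤μ) in τ∈ , σ′∈ , τ-σ′∈)

  -- The two truncations of the original series

  summand : ℕ → ℚ
  summand k = (- 1ℚ) ^ k * fromℕ (8 ℕ.* k ℕ.+ 1) * (pochhammer a k ^ 3 * (1/ k !) ^ 3)

  A-0≡ : ∀ k → (- 1ℚ) ^ k * (pochhammer a k ^ 3 * (1/ k !) ^ 3) ≡ A 0ℚ k
  A-0≡ zero    = refl
  A-0≡ (suc k) = combine₂ ((0ℚ - x * x * x) * i) previous (s * Q * (f * f * f) * (x * x * x)) (*-⁻¹ (v-0≢0 k))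
    (identity s (pochhammer a k) f J x i (A 0ℚ k))
    where
    s Q f J x i : ℚ
    s = (- 1ℚ) ^ k
    Q = pochhammer a k * pochhammer a k * pochhammer a k
    f = 1/ suc k !
    J = fromℕ (suc k)
    x = a + fromℕ k
    i = v 0ℚ (suc k) ⁻¹
    previous : s * (pochhammer a k ^ 3 * (J * f) ^ 3) ≡ A 0ℚ k
    previous = trans (cong (λ h → s * (pochhammer a k ^ 3 * h ^ 3)) (suc*1/suc! k)) (A-0≡ k)
    identity : ∀ s q f J x i A → (- 1ℚ) * s * ((q * x) * ((q * x) * ((q * x) * 1ℚ)) * (f * (f * (f * 1ℚ)))) ≡
      A * ((0ℚ - x * x * x) * i)
      + (0ℚ - x * x * x) * i * (s * (q * (q * (q * 1ℚ)) * (J * f * (J * f * (J * f * 1ℚ)))) - A)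
      + s * (q * q * q) * (f * f * f) * (x * x * x) * ((J * J * J + 0ℚ) * i - 1ℚ)
    identity = solve-∀ ℚ-ring

  ∑-summand : ∀ M → ∑[k≤ M ] summand ≡ G 0ℚ M
  ∑-summand M = ∑-cong M λ k _ → trans (commute ((- 1ℚ) ^ k) (fromℕ (8 ℕ.* k ℕ.+ 1)) (pochhammer a k ^ 3 * (1/ k !) ^ 3))
    (cong₂ _*_ (trans (fromℕ-+ (8 ℕ.* k) 1) (cong (_+ 1ℚ) (fromℕ-* 8 k))) (A-0≡ k))
    where
    commute : ∀ s w z → s * w * z ≡ w * (s * z)
    commute = solve-∀ ℚ-ring

  p³/16 : (+ (p ℕ.^ 3)) / 16 ≡ P * (u * u)
  p³/16 = begin
    (+ (p ℕ.^ 3)) / 16             ≡⟨ cong (_/ 16) (sym (ℤ.*-identityʳ (+ (p ℕ.^ 3)))) ⟩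
    (+ (p ℕ.^ 3) ℤ.* + 1) / 16    ≡⟨ cong (_* (+ 1 / 16)) (fromℤ-mkℚ (+ (p ℕ.^ 3))) ⟩
    fromℕ (p ℕ.^ 3) * (+ 1 / 16)   ≡⟨ cong (_* (+ 1 / 16)) (fromℕ-^ p 3) ⟩
    P ^ 3 * (+ 1 / 16)             ≡⟨ identity P ⟩
    P * (P * a * (P * a))          ≡⟨ cong (λ x → P * (x * x)) (sym u≡) ⟩
    P * (u * u)                    ∎
    where
    identity : ∀ P → P * (P * (P * 1ℚ)) * (+ 1 / 16) ≡ P * (P * (+ 1 / 4) * (P * (+ 1 / 4)))
    identity = solve-∀ ℚ-ring

  rhs : ℚ
  rhs = P * (- 1ℚ) ^ n + (+ (p ℕ.^ 3)) / 16 * eulerPolynomial m a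

  short-sum : ∑[k≤ n ] summand - rhs ∈𝔭^ 4
  short-sum = ∈-resp (trans (identity (G 0ℚ n) (G κ n) (P * (- 1ℚ) ^ n + P * (u * u) * eulerPolynomial m a))
      (cong₂ (λ x y → x - (P * (- 1ℚ) ^ n + y * eulerPolynomial m a)) (sym (∑-summand n)) (sym p³/16)))
    (Evaluation.G-κ≡ ∈- Perturbation.G-G₀∈)
    where
    identity : ∀ G₀ G r → G - r - (G - G₀) ≡ G₀ - r
    identity = solve-∀ ℚ-ring

  long-sum : ∑[k≤ 2 ℕ.+ m ] summand - rhs ∈𝔭^ 4
  long-sum = ∈-resp (trans (identity (G 0ℚ (2 ℕ.+ m)) (G 0ℚ n) rhs) (cong (_- rhs) (sym (∑-summand (2 ℕ.+ m)))))
    (Tail.tail∈ ∈+ ∈-resp (cong (_- rhs) (∑-summand n)) short-sum)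
    where
    identity : ∀ G₁ G₀ r → G₁ - G₀ + (G₀ - r) ≡ G₁ - r
    identity = solve-∀ ℚ-ring

  congruence : ∀ M → M ≡ n ⊎ M ≡ 2 ℕ.+ m → ∑[k≤ M ] summand - rhs ∈𝔭^ 4
  congruence _ (inj₁ refl) = short-sum
  congruence _ (inj₂ refl) = long-sum

p≡1+4n : ∀ m → (3 ℕ.+ m) % 4 ≡ 1 → ∃[ n′ ] 3 ℕ.+ m ≡ 1 ℕ.+ 4 ℕ.* suc n′
p≡1+4n m p%4≡1 with (3 ℕ.+ m) ℕ./ 4 | m≡m%n+[m/n]*n (3 ℕ.+ m) 4
-- Quotient 0 would mean p = 1, against p = 3 + m; so n is positive.
... | zero   | p≡ with () ← trans p≡ (cong (ℕ._+ 0) p%4≡1)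
... | suc n′ | p≡ = n′ , trans p≡ (cong₂ ℕ._+_ p%4≡1 (ℕ.*-comm (suc n′) 4))

theorem1p2 : (p : ℕ) → Prime p → p % 4 ≡ 1 →
    (M : ℕ) → (M ≡ (p ∸ 1) ℕ./ 4 ⊎ M ≡ p ∸ 1) →
    ∑[k≤ M ] (λ k → (- 1ℚ) ^ k * fromℕ (8 ℕ.* k ℕ.+ 1) * (pochhammer (+ 1 / 4) k ^ 3 * (1/ k !) ^ 3))
    ≡ fromℕ p * (- 1ℚ) ^ ((p ∸ 1) ℕ./ 4) + ((+ (p ℕ.^ 3)) / 16) * eulerPolynomial (p ∸ 3) (+ 1 / 4)
    [mod p ^ 4 ]
-- The values 0 and 2 are excluded by computing the residue mod 4; the value 1 passes that test and
-- is excluded by primality.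
theorem1p2 1 prime[1] _ = contradiction prime[1] ¬prime[1]
theorem1p2 (suc (suc (suc m))) p-prime p%4≡1 M M≡ with p≡1+4n m p%4≡1
... | n′ , p≡ = ∈𝔭⇒∈ℤₚ (subst (λ l → ∑[k≤ M ] summand - (P * (- 1ℚ) ^ l + (+ (p ℕ.^ 3)) / 16 * eulerPolynomial m a) ∈𝔭^ 4)
  (sym n≡) (congruence M (subst (λ l → M ≡ l ⊎ M ≡ 2 ℕ.+ m) n≡ M≡)))
  where
  open Residues m p-prime
  open Truncation m p-prime n′ p≡
  n≡ : (2 ℕ.+ m) ℕ./ 4 ≡ n
  n≡ = trans (cong (ℕ._/ 4) (trans (ℕ.suc-injective p≡) (ℕ.*-comm 4 n))) (m*n/n≡m n 4)
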